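{- Let $N\ge 3$, let $W_{N+1}$ be the wheel graph with central vertex $c$ and set of rim vertices $V_{\mathrm{rim}}=\{v_1,\ldots,v_N\}$, and for $1\le r\le N$ put $$A_{N,r}=\sum_{\substack{R\subseteq V_{\mathrm{rim}}\\ |R|=r}}\mathcal F_{W_{N+1}}(R),\qquad B_{N,r}=\sum_{\substack{R\subseteq V_{\mathrm{rim}}\\ |R|=r}}\mathcal F_{W_{N+1}}(\{c\}\cup R).$$ Then for every integer $1\le r\le N$, $$A_{N,r}=N[z^{N-r}]\frac{1+z}{(1-z)(1-3z+z^2)^r},\qquad B_{N,r}=\frac{N}{r}[z^{N-r}]\frac{1}{(1-3z+z^2)^r}.$$
   Context: The wheel graph $W_{N+1}$ ($N\ge3$) has vertex set $\{c,v_1,\ldots,v_N\}$ and edges $\{v_i,v_{i+1}\}$ (indices modulo $N$) and $\{c,v_i\}$ for $1\le i\le N$. For a finite connected graph $G$ and $\varnothing\ne S\subseteq V(G)$, a rooted spanning forest of $G$ with root set $S$ is a spanning forest (an acyclic subgraph containing all vertices of $G$) in which each connected component contains exactly one vertex of $S$; $\mathcal F_G(S)$ denotes the number of such forests. For a formal power series $f(z)$, $[z^n]f(z)$ denotes the coefficient of $z^n$ in $f(z)$. -}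

module Defs where

import Algebra.Properties.CommutativeMonoid.Sum as Summation
open import Data.Fin.Base as Fin using (Fin; zero; suc; toℕ; splitAt; fromℕ<)
open import Data.Fin.Properties as Fin using (any?; all?; toℕ-fromℕ<; suc-injective; injective⇒≤)
open import Data.Fin.Subset using (Subset; inside; outside; ∣_∣; _∈_)
open import Data.Fin.Subset.Properties using (_∈?_)
open import Data.Integer.Base as ℤ using (ℤ; +_; 0ℤ; 1ℤ)
import Data.Integer.Properties as ℤ
open import Data.List.Base as List using (List; []; _∷_; _++_; filter; length; allFin)
open import Data.List.Membership.Propositional as List using ()
open import Data.List.Membership.Propositional.Properties using (∈-allFin; ∈-filter⁺; ∈-filter⁻)
open import Data.List.Relation.Unary.Any using (here; there)
open import Data.Nat.Base as ℕ using (ℕ; zero; suc; NonZero; _≤_; _<_; _∸_; z≤n; s≤s)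
open import Data.Nat.Divisibility using (divides; >⇒∤)
open import Data.Nat.DivMod using (_%_; _/_; _mod_; m%n<n; m≡m%n+[m/n]*n; %-distribˡ-+; m%n%n≡m%n)
import Data.Nat.ListAction as ListAction
import Data.Nat.Properties as ℕ
open import Data.Product using (Σ; ∃; ∃!; _×_; _,_; proj₁; proj₂)
open import Data.Product.Properties using (,-injective; ≡-dec)
open import Data.Sum.Base using (_⊎_; inj₁; inj₂; [_,_]′)
open import Data.Vec.Base as Vec using (Vec; []; _∷_; lookup)
open import Data.Vec.Relation.Unary.AllPairs using (allPairs?)
open import Data.Vec.Relation.Unary.Unique.Propositional using (Unique)
open import Data.Vec.Relation.Unary.Unique.Propositional.Properties using (lookup-injective)
open import Relation.Binary.Core using (Rel)
open import Relation.Binary.Construct.Closure.ReflexiveTransitive as Star using (Star; ε; _◅_; _◅◅_)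
open import Relation.Binary.PropositionalEquality
open import Relation.Nullary using (¬_; Dec; contradiction)
open import Relation.Nullary.Decidable using (map′; _×-dec_; _⊎-dec_; _→-dec_; ¬?)

-- Cyclic successor: the index i + 1 modulo n.
next : ∀ {n} .{{_ : NonZero n}} → Fin n → Fin n
next {n} i = suc (toℕ i) mod n

------------------------------------------------------------------------
-- Finite simple graphs

-- Each edge is listed once, under an arbitrary orientation; `Joins`
-- forgets the orientation.
record Graph : Set where
  field
    order : ℕ
    size  : ℕ
    ends  : Fin size → Fin order × Fin order

  Vertex : Set
  Vertex = Fin order

  Edge : Set
  Edge = Fin size

  Joins : Edge → Vertex → Vertex → Set
  Joins e u v = ends e ≡ (u , v) ⊎ ends e ≡ (v , u)

  field
    loopless : ∀ {e v} → ¬ Joins e v v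
    simple   : ∀ {e f u v} → Joins e u v → Joins f u v → e ≡ f

------------------------------------------------------------------------
-- Rooted spanning forests

module _ (G : Graph) where
  open Graph G

  -- A subgraph containing all the vertices is given by its set of edges.
  SpanningSubgraph : Set
  SpanningSubgraph = Subset size

  Adjacent : SpanningSubgraph → Rel Vertex _
  Adjacent H u v = ∃ λ e → e ∈ H × Joins e u v

  Connected : SpanningSubgraph → Rel Vertex _
  Connected H = Star (Adjacent H)

  -- A cycle: at least three distinct vertices, cyclically adjacent.
  HasCycle : SpanningSubgraph → Set
  HasCycle H = ∃ λ k → Σ (Vec Vertex (3 ℕ.+ k)) λ c →
    Unique c × (∀ i → Adjacent H (lookup c i) (lookup c (next i)))

  Acyclic : SpanningSubgraph → Set
  Acyclic H = ¬ HasCycle H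

  -- Every component is the component of some vertex v.
  record IsRootedSpanningForest (S : Subset order) (H : SpanningSubgraph) : Set where
    constructor rootedForest
    field
      acyclic    : Acyclic H
      uniqueRoot : ∀ (v : Vertex) → ∃! _≡_ λ s → s ∈ S × Connected H v s

------------------------------------------------------------------------
-- Decidability of being a rooted spanning forest

anyVec? : ∀ {n k} {P : Vec (Fin n) k → Set} → (∀ c → Dec (P c)) → Dec (∃ P)
anyVec? {k = zero}  P? = map′ ([] ,_) (λ { ([] , p) → p }) (P? [])
anyVec? {k = suc k} P? =
  map′ (λ { (x , c , p) → x ∷ c , p }) (λ { (x ∷ c , p) → x , c , p })
       (any? λ x → anyVec? λ c → P? (x ∷ c))

module _ (G : Graph) where
  open Graph G

  joins? : ∀ e u v → Dec (Joins e u v)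
  joins? e u v = ≡-dec Fin._≟_ Fin._≟_ (ends e) (u , v)
           ⊎-dec ≡-dec Fin._≟_ Fin._≟_ (ends e) (v , u)

  adjacent? : ∀ H u v → Dec (Adjacent G H u v)
  adjacent? H u v = any? λ e → (e ∈? H) ×-dec joins? e u v

  hasCycle? : ∀ H → Dec (HasCycle G H)
  hasCycle? H = map′ to from (any? cycleOfLength?)
    where
    IsCycle : ∀ {k} → Vec Vertex (3 ℕ.+ k) → Set
    IsCycle c = Unique c × (∀ i → Adjacent G H (lookup c i) (lookup c (next i)))

    cycleOfLength? : (k : Fin order) → Dec (∃ λ (c : Vec Vertex (3 ℕ.+ toℕ k)) → IsCycle c)
    cycleOfLength? k = anyVec? λ c →
      allPairs? (λ u v → ¬? (u Fin.≟ v)) c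
        ×-dec all? λ i → adjacent? H (lookup c i) (lookup c (next i))

    to : (∃ λ k → ∃ λ (c : Vec Vertex (3 ℕ.+ toℕ k)) → IsCycle c) → HasCycle G H
    to (k , c) = toℕ k , c

    from : HasCycle G H → ∃ λ (k : Fin order) → ∃ λ (c : Vec Vertex (3 ℕ.+ toℕ k)) → IsCycle c
    from (k , c , u , a) = fromℕ< k<n ,
      subst (λ j → ∃ λ (c : Vec Vertex (3 ℕ.+ j)) → IsCycle c) (sym (toℕ-fromℕ< k<n)) (c , u , a)
      where
      k<n : k < order
      k<n = ℕ.≤-trans (ℕ.m≤n+m (suc k) 2) (injective⇒≤ (lookup-injective u _ _))

  -- Connectedness by the edges of a list, one edge at a time.
  private
    Via : List Edge → Rel Vertex _
    Via es u v = ∃ λ e → e List.∈ es × Joins e u v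

    Through : Edge → List Edge → Rel Vertex _
    Through e es u v = Star (Via es) u v
      ⊎ (Star (Via es) u (proj₁ (ends e)) × Star (Via es) (proj₂ (ends e)) v)
      ⊎ (Star (Via es) u (proj₂ (ends e)) × Star (Via es) (proj₁ (ends e)) v)

    weaken : ∀ {e es u v} → Star (Via es) u v → Star (Via (e ∷ es)) u v
    weaken = Star.map λ { (f , f∈ , j) → f , there f∈ , j }

    through⇒ : ∀ {e es u v} → Through e es u v → Star (Via (e ∷ es)) u v
    through⇒ (inj₁ p)              = weaken p
    through⇒ (inj₂ (inj₁ (p , q))) = weaken p ◅◅ (_ , here refl , inj₁ refl) ◅ weaken q
    through⇒ (inj₂ (inj₂ (p , q))) = weaken p ◅◅ (_ , here refl , inj₂ refl) ◅ weaken q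

    prepend : ∀ {e es u v w} → Via (e ∷ es) u v → Through e es v w → Through e es u w
    prepend (f , there f∈ , j) (inj₁ p)              = inj₁ ((f , f∈ , j) ◅ p)
    prepend (f , there f∈ , j) (inj₂ (inj₁ (p , q))) = inj₂ (inj₁ ((f , f∈ , j) ◅ p , q))
    prepend (f , there f∈ , j) (inj₂ (inj₂ (p , q))) = inj₂ (inj₂ ((f , f∈ , j) ◅ p , q))
    prepend (f , here refl , inj₁ refl) (inj₁ p)              = inj₂ (inj₁ (ε , p))
    prepend (f , here refl , inj₁ refl) (inj₂ (inj₁ (p , q))) = inj₂ (inj₁ (ε , q))
    prepend (f , here refl , inj₁ refl) (inj₂ (inj₂ (p , q))) = inj₁ q
    prepend (f , here refl , inj₂ refl) (inj₁ p)              = inj₂ (inj₂ (ε , p))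
    prepend (f , here refl , inj₂ refl) (inj₂ (inj₁ (p , q))) = inj₁ q
    prepend (f , here refl , inj₂ refl) (inj₂ (inj₂ (p , q))) = inj₂ (inj₂ (ε , q))

    ⇒through : ∀ {e es u v} → Star (Via (e ∷ es)) u v → Through e es u v
    ⇒through ε       = inj₁ ε
    ⇒through (s ◅ p) = prepend s (⇒through p)

    via? : ∀ es u v → Dec (Star (Via es) u v)
    via? []       u v = map′ (λ { refl → ε }) (λ { ε → refl ; ((_ , () , _) ◅ _) }) (u Fin.≟ v)
    via? (e ∷ es) u v = map′ through⇒ ⇒through
      (via? es u v
        ⊎-dec (via? es u (proj₁ (ends e)) ×-dec via? es (proj₂ (ends e)) v)
        ⊎-dec (via? es u (proj₂ (ends e)) ×-dec via? es (proj₁ (ends e)) v))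

  connected? : ∀ H u v → Dec (Connected G H u v)
  connected? H u v = map′
    (Star.map λ { (e , e∈ , j) → e , proj₂ (∈-filter⁻ (_∈? H) {xs = allFin size} e∈) , j })
    (Star.map λ { (e , e∈ , j) → e , ∈-filter⁺ (_∈? H) (∈-allFin e) e∈ , j })
    (via? (filter (_∈? H) (allFin size)) u v)

  isRootedSpanningForest? : ∀ S H → Dec (IsRootedSpanningForest G S H)
  isRootedSpanningForest? S H =
    map′ (λ { (a , u) → rootedForest a u }) (λ { (rootedForest a u) → a , u })
      (¬? (hasCycle? H) ×-dec all? λ v → any? λ s → root? v s ×-dec
        map′ (λ f {t} → f t) (λ f t → f {t}) (all? λ t → root? v t →-dec (s Fin.≟ t)))
    where
    root? : ∀ v s → Dec (s ∈ S × Connected G H v s)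
    root? v s = (s ∈? S) ×-dec connected? H v s

------------------------------------------------------------------------
-- Counting rooted spanning forests

-- All subsets of Fin n, each listed exactly once.
subsets : ∀ n → List (Subset n)
subsets zero    = [] ∷ []
subsets (suc n) = List.map (inside ∷_) (subsets n) ++ List.map (outside ∷_) (subsets n)

ℱ : (G : Graph) → Subset (Graph.order G) → ℕ
ℱ G S = length (filter (isRootedSpanningForest? G S) (subsets (Graph.size G)))

------------------------------------------------------------------------
-- Wheel graphs

-- `zero` is the centre c and `suc i` is the rim vertex with index i; among the
-- N + N edges, the first N are the rim edges and the last N the spokes.
wheelEnds : ∀ N .{{_ : NonZero N}} → Fin N ⊎ Fin N → Fin (suc N) × Fin (suc N)
wheelEnds N (inj₁ i) = suc i , suc (next i)
wheelEnds N (inj₂ i) = zero , suc i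

private
  shift≢ : ∀ {d i n} .{{_ : NonZero n}} .{{_ : NonZero d}} → d < n → (d ℕ.+ i) % n ≢ i
  shift≢ {d} {i} {n} d<n eq = >⇒∤ d<n (divides ((d ℕ.+ i) / n) (ℕ.+-cancelʳ-≡ i d _ (begin
    d ℕ.+ i                                   ≡⟨ m≡m%n+[m/n]*n (d ℕ.+ i) n ⟩
    (d ℕ.+ i) % n ℕ.+ (d ℕ.+ i) / n ℕ.* n     ≡⟨ cong (ℕ._+ (d ℕ.+ i) / n ℕ.* n) eq ⟩
    i ℕ.+ (d ℕ.+ i) / n ℕ.* n                 ≡⟨ ℕ.+-comm i _ ⟩
    (d ℕ.+ i) / n ℕ.* n ℕ.+ i                 ∎)))
    where open ≡-Reasoning

  toℕ-next : ∀ {n} .{{_ : NonZero n}} (i : Fin n) → toℕ (next i) ≡ suc (toℕ i) % n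
  toℕ-next {n} i = toℕ-fromℕ< (m%n<n (suc (toℕ i)) n)

  next≢ : ∀ {n} .{{_ : NonZero n}} → 1 < n → (i : Fin n) → next i ≢ i
  next≢ 1<n i eq = shift≢ 1<n (trans (sym (toℕ-next i)) (cong toℕ eq))

  next²≢ : ∀ {n} .{{_ : NonZero n}} → 2 < n → (i : Fin n) → next (next i) ≢ i
  next²≢ {n} 2<n i eq = shift≢ 2<n (begin
    (2 ℕ.+ toℕ i) % n                         ≡⟨ %-distribˡ-+ 1 (suc (toℕ i)) n ⟩
    (1 % n ℕ.+ suc (toℕ i) % n) % n           ≡⟨ cong (λ x → (1 % n ℕ.+ x) % n) (m%n%n≡m%n (suc (toℕ i)) n) ⟨
    (1 % n ℕ.+ suc (toℕ i) % n % n) % n       ≡⟨ %-distribˡ-+ 1 (suc (toℕ i) % n) n ⟨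
    suc (suc (toℕ i) % n) % n                 ≡⟨ cong (λ x → suc x % n) (toℕ-next i) ⟨
    suc (toℕ (next i)) % n                    ≡⟨ toℕ-next (next i) ⟨
    toℕ (next (next i))                       ≡⟨ cong toℕ eq ⟩
    toℕ i                                     ∎)
    where open ≡-Reasoning

  Joins′ : ∀ N .{{_ : NonZero N}} → Fin N ⊎ Fin N → Rel (Fin (suc N)) _
  Joins′ N e u v = wheelEnds N e ≡ (u , v) ⊎ wheelEnds N e ≡ (v , u)

  wheel-loopless : ∀ {N} .{{_ : NonZero N}} → 3 ≤ N → ∀ e {v} → wheelEnds N e ≢ (v , v)
  wheel-loopless 3≤N (inj₁ i) eq with ,-injective eq
  ... | refl , e = next≢ (ℕ.<⇒≤ 3≤N) i (suc-injective e)
  wheel-loopless 3≤N (inj₂ i) ()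

  wheel-simple : ∀ {N} .{{_ : NonZero N}} → 3 ≤ N → ∀ e f {u v} →
                 Joins′ N e u v → Joins′ N f u v → e ≡ f
  wheel-simple 3≤N (inj₁ i) (inj₁ j) (inj₁ refl) (inj₁ q) =
    cong inj₁ (sym (suc-injective (proj₁ (,-injective q))))
  wheel-simple 3≤N (inj₁ i) (inj₁ j) (inj₂ refl) (inj₂ q) =
    cong inj₁ (sym (suc-injective (proj₁ (,-injective q))))
  wheel-simple 3≤N (inj₁ i) (inj₁ j) (inj₁ refl) (inj₂ q) with ,-injective q
  ... | refl , b = contradiction (suc-injective b) (next²≢ 3≤N i)
  wheel-simple 3≤N (inj₁ i) (inj₁ j) (inj₂ refl) (inj₁ q) with ,-injective q
  ... | refl , b = contradiction (suc-injective b) (next²≢ 3≤N i)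
  wheel-simple 3≤N (inj₁ i) (inj₂ j) (inj₁ refl) (inj₁ ())
  wheel-simple 3≤N (inj₁ i) (inj₂ j) (inj₁ refl) (inj₂ ())
  wheel-simple 3≤N (inj₁ i) (inj₂ j) (inj₂ refl) (inj₁ ())
  wheel-simple 3≤N (inj₁ i) (inj₂ j) (inj₂ refl) (inj₂ ())
  wheel-simple 3≤N (inj₂ i) (inj₁ j) (inj₁ refl) (inj₁ ())
  wheel-simple 3≤N (inj₂ i) (inj₁ j) (inj₁ refl) (inj₂ ())
  wheel-simple 3≤N (inj₂ i) (inj₁ j) (inj₂ refl) (inj₁ ())
  wheel-simple 3≤N (inj₂ i) (inj₁ j) (inj₂ refl) (inj₂ ())
  wheel-simple 3≤N (inj₂ i) (inj₂ j) (inj₁ refl) (inj₁ refl) = refl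
  wheel-simple 3≤N (inj₂ i) (inj₂ j) (inj₁ refl) (inj₂ ())
  wheel-simple 3≤N (inj₂ i) (inj₂ j) (inj₂ refl) (inj₁ ())
  wheel-simple 3≤N (inj₂ i) (inj₂ j) (inj₂ refl) (inj₂ refl) = refl

  splitAt-injective : ∀ m {n} {i j : Fin (m ℕ.+ n)} → splitAt m i ≡ splitAt m j → i ≡ j
  splitAt-injective m {n} {i} {j} eq =
    trans (sym (Fin.join-splitAt m n i)) (trans (cong (Fin.join m n) eq) (Fin.join-splitAt m n j))

-- The wheel with N rim vertices, that is W_{N+1}.
wheel : (N : ℕ) → 3 ≤ N → Graph
wheel N 3≤N = record
  { order    = suc N
  ; size     = N ℕ.+ N
  ; ends     = λ e → wheelEnds N (splitAt N e)
  ; loopless = λ {e} → [ wheel-loopless 3≤N (splitAt N e) , wheel-loopless 3≤N (splitAt N e) ]′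
  ; simple   = λ {e} {f} p q → splitAt-injective N (wheel-simple 3≤N (splitAt N e) (splitAt N f) p q)
  }
  where instance _ = ℕ.>-nonZero (ℕ.≤-trans (s≤s z≤n) 3≤N)

-- A set R of rim vertices is a subset of the index set Fin N.
rimSets : (N r : ℕ) → List (Subset N)
rimSets N r = filter (λ R → ∣ R ∣ ℕ.≟ r) (subsets N)

rim : ∀ {N} → Subset N → Subset (suc N)
rim R = outside ∷ R

c∪rim : ∀ {N} → Subset N → Subset (suc N)
c∪rim R = inside ∷ R

A : (N : ℕ) → 3 ≤ N → ℕ → ℕ
A N 3≤N r = ListAction.sum (List.map (λ R → ℱ (wheel N 3≤N) (rim R)) (rimSets N r))

B : (N : ℕ) → 3 ≤ N → ℕ → ℕ
B N 3≤N r = ListAction.sum (List.map (λ R → ℱ (wheel N 3≤N) (c∪rim R)) (rimSets N r))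

------------------------------------------------------------------------
-- Formal power series over ℤ, as coefficient sequences

open Summation ℤ.+-0-commutativeMonoid using (sum; sum-cong-≗)

Series : Set
Series = ℕ → ℤ

infix  6 [z^_]_
infixl 7 _⊛_ _⊘_
infixr 8 _^_
infix  9 _⁻¹

[z^_]_ : ℕ → Series → ℤ
[z^ n ] f = f n

-- The polynomial with the given coefficients, lowest degree first.
poly : List ℤ → Series
poly []       n       = 0ℤ
poly (a ∷ as) zero    = a
poly (a ∷ as) (suc n) = poly as n

one : Series
one = poly (1ℤ ∷ [])

_⊛_ : Series → Series → Series
(f ⊛ g) n = sum {suc n} λ i → f (toℕ i) ℤ.* g (n ∸ toℕ i)

_^_ : Series → ℕ → Series
f ^ zero  = one
f ^ suc r = f ⊛ f ^ r

-- The first n + 1 coefficients of 1 / f, highest degree first.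
inverseCoeffs : Series → ∀ n → Vec ℤ (suc n)
inverseCoeffs f zero    = 1ℤ ∷ []
inverseCoeffs f (suc n) =
  ℤ.- sum (λ i → f (suc (toℕ i)) ℤ.* lookup (inverseCoeffs f n) i) ∷ inverseCoeffs f n

-- The multiplicative inverse of a series with constant term 1 (see
-- `⁻¹-inverseʳ`); not meaningful for other series.
_⁻¹ : Series → Series
(f ⁻¹) n = Vec.head (inverseCoeffs f n)

_⊘_ : Series → Series → Series
f ⊘ g = f ⊛ g ⁻¹

lookup-inverseCoeffs : ∀ f n i → lookup (inverseCoeffs f n) i ≡ (f ⁻¹) (n ∸ toℕ i)
lookup-inverseCoeffs f zero    zero    = refl
lookup-inverseCoeffs f (suc n) zero    = refl
lookup-inverseCoeffs f (suc n) (suc i) = lookup-inverseCoeffs f n i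

⁻¹-inverseʳ : ∀ f → f 0 ≡ 1ℤ → f ⊛ f ⁻¹ ≗ one
⁻¹-inverseʳ f f₀ zero    rewrite f₀ = refl
⁻¹-inverseʳ f f₀ (suc n) = begin
  f 0 ℤ.* ℤ.- s ℤ.+ t   ≡⟨ cong₂ (λ x y → x ℤ.* ℤ.- s ℤ.+ y) f₀ t≡s ⟩
  1ℤ ℤ.* ℤ.- s ℤ.+ s    ≡⟨ cong (ℤ._+ s) (ℤ.*-identityˡ (ℤ.- s)) ⟩
  ℤ.- s ℤ.+ s           ≡⟨ ℤ.+-inverseˡ s ⟩
  0ℤ                    ∎
  where
  open ≡-Reasoning
  s t : ℤ
  s = sum {suc n} λ i → f (suc (toℕ i)) ℤ.* lookup (inverseCoeffs f n) i
  t = sum {suc n} λ i → f (suc (toℕ i)) ℤ.* (f ⁻¹) (n ∸ toℕ i)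
  t≡s : t ≡ s
  t≡s = sum-cong-≗ {suc n} λ i → cong (f (suc (toℕ i)) ℤ.*_) (sym (lookup-inverseCoeffs f n i))

1+z 1-z 1-3z+z² : Series
1+z     = poly (+ 1 ∷ + 1 ∷ [])
1-z     = poly (+ 1 ∷ ℤ.- + 1 ∷ [])
1-3z+z² = poly (+ 1 ∷ ℤ.- + 3 ∷ + 1 ∷ [])

-- The two denominators to be inverted have constant term 1.
1-3z+z²^r-constant : ∀ r → (1-3z+z² ^ r) 0 ≡ 1ℤ
1-3z+z²^r-constant zero    = refl
1-3z+z²^r-constant (suc r) rewrite 1-3z+z²^r-constant r = refl

1-z⊛1-3z+z²^r-constant : ∀ r → (1-z ⊛ 1-3z+z² ^ r) 0 ≡ 1ℤ
1-z⊛1-3z+z²^r-constant r rewrite 1-3z+z²^r-constant r = refl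

{-# OPTIONS --safe #-}
module Submission where

-- Let every rim vertex of a forest rooted at c ∪ R point to its parent: it is a
-- root (ρ), or its parent is the centre (κ), the previous (◂) or the next (▸) rim
-- vertex. If R is not empty, this identifies the forests with the cyclic words over
-- ρ, κ, ◂, ▸ in which ▸ is never followed by ◂ (the two would share an edge). A forest
-- rooted at R alone becomes one of this kind when the component of c is rerooted at
-- c, so it is a word together with a rim vertex i from which the parents lead to κ;
-- by rotation, i may be taken to be the first vertex.
--
-- Without the cyclic condition the words are counted by 1 / (1 - (3 + y) z + z²), where
-- y marks ρ. The coefficient of yʳ is zʳ / (1 - 3z + z²)ʳ⁺¹. A linear word fails to be
-- cyclic exactly when it is ◂ ⋯ ▸, hence the factor 1 - z² for cyclic words, and
-- r (1 - z²) / (1 - 3z + z²)ʳ⁺¹ is (z d/dz + r) applied to 1 / (1 - 3z + z²)ʳ. In the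
-- words where the first vertex leads to κ, removing this κ and the arrows leading to it
-- leaves an arbitrary shorter linear word, which yields the factor (1 + z) / (1 - z).

open import Defs
open import Data.Bool.Base using (if_then_else_)
open import Data.Empty using (⊥)
open import Data.Fin.Base as Fin using (Fin; zero; suc; toℕ; fromℕ; inject₁; splitAt; join)
import Data.Fin.Properties as Fin
open import Data.Fin.Relation.Unary.Top using (view; ‵fromℕ; ‵inject₁)
open import Data.Fin.Subset using (Subset; inside; outside; _∈_; _∉_; ∣_∣)
open import Data.Fin.Subset.Properties using (_∈?_; ⊆-antisym; ∣p∣≤n)
open import Data.Integer.Base as ℤ using (ℤ; +_; 0ℤ; 1ℤ)
import Data.Integer.Properties as ℤ
import Algebra.Properties.AbelianGroup ℤ.+-0-abelianGroup as ℤ+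
import Data.Integer.Tactic.RingSolver as ℤ-Solver
open import Data.List.Base as List
  using (List; []; _∷_; _++_; filter; length; allFin; cartesianProduct; cartesianProductWith)
open import Data.List.Membership.Propositional as List using ()
open import Data.List.Membership.Propositional.Properties
  using (∈-map⁺; ∈-map⁻; ∈-++⁺ˡ; ∈-++⁺ʳ; ∈-filter⁺; ∈-filter⁻; ∈-allFin; ∈-cartesianProduct⁺; ∈-cartesianProductWith⁺)
open import Data.List.Membership.Propositional.Properties.WithK using (unique∧set⇒bag)
import Data.List.Properties as List
open import Data.List.Relation.Binary.BagAndSetEquality using (∼bag⇒↭)
open import Data.List.Relation.Binary.Permutation.Propositional.Properties using (↭-length)
import Data.List.Relation.Unary.All as All
import Data.List.Relation.Unary.All.Properties as All
open import Data.List.Relation.Unary.AllPairs using ([]; _∷_)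
open import Data.List.Relation.Unary.Any using (here; there)
open import Data.List.Relation.Unary.Unique.Propositional as List using ()
import Data.List.Relation.Unary.Unique.Propositional.Properties as Unique
open import Data.Nat.Base as ℕ
  using (ℕ; zero; suc; NonZero; _≤_; _<_; _+_; _*_; _∸_; z≤n; s≤s; >-nonZero)
open import Data.Nat.DivMod
  using (_%_; m%n<n; m%n≤m; n%n≡0; m<n⇒m%n≡m; m%n%n≡m%n; [m+n]%n≡m%n; %-distribˡ-+)
open import Data.Nat.ListAction as ListAction using ()
import Data.Nat.Properties as ℕ
import Data.Nat.Tactic.RingSolver as ℕ-Solver
open import Data.Product using (∃; ∃₂; ∃!; _×_; _,_; proj₁; proj₂)
open import Data.Rational.Base as ℚ using (_/_)
import Data.Rational.Properties as ℚ
open import Data.Rational.Unnormalised.Base as ℚᵘ using (mkℚᵘ; *≡*)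
import Data.Rational.Unnormalised.Properties as ℚᵘ
open import Data.Sum.Base as Sum using (_⊎_; inj₁; inj₂)
open import Data.Unit using (⊤; tt)
open import Data.Vec.Base as Vec
  using (Vec; []; _∷_; _∷ʳ_; lookup; tabulate; initLast; _[_]≔_; here; there)
open import Data.Vec.Properties
  using (∷-injective; ∷ʳ-injective; lookup∘tabulate; tabulate∘lookup; tabulate-cong; lookup⇒[]=; []=⇒lookup;
         []≔-idempotent; []≔-lookup; []≔-updates; []≔-minimal; lookup∘update; lookup∘update′)
import Data.Vec.Relation.Unary.All.Properties as VecAll
open import Data.Vec.Relation.Unary.AllPairs using (_∷_)
import Data.Vec.Relation.Unary.Unique.Propositional.Properties as VecUnique
open import Function.Base using (_∘_; case_of_; flip)
open import Function.Bundles using (mk⇔)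
open import Relation.Binary.Construct.Closure.ReflexiveTransitive as Star using (ε; _◅_; _◅◅_)
open import Relation.Binary.Definitions using (DecidableEquality; tri<; tri≈; tri>)
open import Relation.Binary.PropositionalEquality
open import Relation.Nullary using (¬_; contradiction; Dec; yes; no; does)
open import Relation.Nullary.Decidable using (_⊎-dec_; _×-dec_; _→-dec_; ¬?; map′; dec-true; decidable-stable)
open import Relation.Unary using (Decidable)

-- The difficulty is that a forest is only a set of edges, which does not tell which end of a rim
-- edge is the parent. A vertex that is neither a root nor joined to the centre gets ▸ when the rim
-- edges to its right lead to a vertex of one of these two kinds, and ◂ by default. Since an arc of
-- rim edges contains at most one such vertex, the choice agrees with the edges. Conversely, two
-- words with the same roots and edges could differ only by reversed arrows, and a reversal would
-- spread round the whole rim; a single ρ or κ stops it. This is where a nonempty `R` enters in `B`.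
-- In `A` the roots left after rerooting may be none, but the chain from the chosen rim vertex then
-- supplies a κ. Rerooting also removes one root from `R`, so `A` uses the coefficient of y^(r-1),
-- whose denominator already has the exponent r. `B` uses that of y^r, with exponent r + 1, and
-- needs the differential identity to lower it. The symmetry between ▸ before a word and ◂ after it
-- is derived from recurrences, without reversing words.

-- The cyclic successor and its powers

module _ {n} .{{_ : NonZero n}} where

  toℕ-next : (i : Fin n) → toℕ (next i) ≡ suc (toℕ i) % n
  toℕ-next i = Fin.toℕ-fromℕ< (m%n<n (suc (toℕ i)) n)

  next^ : ℕ → Fin n → Fin n
  next^ zero    i = i
  next^ (suc d) i = next (next^ d i)

  suc-% : ∀ a → suc (a % n) % n ≡ suc a % n
  suc-% a = begin
    suc (a % n) % n              ≡⟨ %-distribˡ-+ 1 (a % n) n ⟩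
    (1 % n + a % n % n) % n      ≡⟨ cong (λ x → (1 % n + x) % n) (m%n%n≡m%n a n) ⟩
    (1 % n + a % n) % n          ≡⟨ %-distribˡ-+ 1 a n ⟨
    suc a % n                    ∎
    where open ≡-Reasoning

  toℕ-next^ : ∀ d i → toℕ (next^ d i) ≡ (d + toℕ i) % n
  toℕ-next^ zero    i = sym (m<n⇒m%n≡m (Fin.toℕ<n i))
  toℕ-next^ (suc d) i = trans (toℕ-next (next^ d i))
    (trans (cong (λ x → suc x % n) (toℕ-next^ d i)) (suc-% (d + toℕ i)))

  next^-+ : ∀ a b i → next^ a (next^ b i) ≡ next^ (a + b) i
  next^-+ zero    b i = refl
  next^-+ (suc a) b i = cong next (next^-+ a b i)

  next^-next : ∀ d i → next^ d (next i) ≡ next^ (suc d) i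
  next^-next d i = trans (next^-+ d 1 i) (cong (λ x → next^ x i) (ℕ.+-comm d 1))

  next^-% : ∀ d i → next^ (d % n) i ≡ next^ d i
  next^-% d i = Fin.toℕ-injective (begin
    toℕ (next^ (d % n) i)          ≡⟨ toℕ-next^ (d % n) i ⟩
    (d % n + toℕ i) % n            ≡⟨ %-distribˡ-+ (d % n) (toℕ i) n ⟩
    (d % n % n + toℕ i % n) % n    ≡⟨ cong (λ x → (x + toℕ i % n) % n) (m%n%n≡m%n d n) ⟩
    (d % n + toℕ i % n) % n        ≡⟨ %-distribˡ-+ d (toℕ i) n ⟨
    (d + toℕ i) % n                ≡⟨ toℕ-next^ d i ⟨
    toℕ (next^ d i)                ∎)
    where open ≡-Reasoning

  next^-n : ∀ i → next^ n i ≡ i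
  next^-n i = Fin.toℕ-injective (begin
    toℕ (next^ n i)    ≡⟨ toℕ-next^ n i ⟩
    (n + toℕ i) % n    ≡⟨ cong (_% n) (ℕ.+-comm n (toℕ i)) ⟩
    (toℕ i + n) % n    ≡⟨ [m+n]%n≡m%n (toℕ i) n ⟩
    toℕ i % n          ≡⟨ m<n⇒m%n≡m (Fin.toℕ<n i) ⟩
    toℕ i              ∎)
    where open ≡-Reasoning

  next^-reach : ∀ i j → ∃ λ d → next^ d i ≡ j
  -- From `i` up to the wrap-around at `n`, then `j` further steps. The distance may exceed `n`;
  -- where this matters, `next^-%` reduces it.
  next^-reach i j = toℕ j + (n ∸ toℕ i) , Fin.toℕ-injective (begin
    toℕ (next^ (toℕ j + (n ∸ toℕ i)) i)    ≡⟨ toℕ-next^ (toℕ j + (n ∸ toℕ i)) i ⟩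
    (toℕ j + (n ∸ toℕ i) + toℕ i) % n      ≡⟨ cong (_% n) (ℕ.+-assoc (toℕ j) (n ∸ toℕ i) (toℕ i)) ⟩
    (toℕ j + (n ∸ toℕ i + toℕ i)) % n      ≡⟨ cong (λ x → (toℕ j + x) % n) (ℕ.m∸n+n≡m (ℕ.<⇒≤ (Fin.toℕ<n i))) ⟩
    (toℕ j + n) % n                        ≡⟨ [m+n]%n≡m%n (toℕ j) n ⟩
    toℕ j % n                              ≡⟨ m<n⇒m%n≡m (Fin.toℕ<n j) ⟩
    toℕ j                                  ∎)
    where open ≡-Reasoning

module _ {n : ℕ} where

  next-inject₁ : (i : Fin n) → next (inject₁ i) ≡ suc i
  next-inject₁ i = Fin.toℕ-injective (begin
    toℕ (next (inject₁ i))            ≡⟨ toℕ-next (inject₁ i) ⟩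
    suc (toℕ (inject₁ i)) % suc n     ≡⟨ cong (λ x → suc x % suc n) (Fin.toℕ-inject₁ i) ⟩
    suc (toℕ i) % suc n               ≡⟨ m<n⇒m%n≡m (s≤s (Fin.toℕ<n i)) ⟩
    suc (toℕ i)                       ∎)
    where open ≡-Reasoning

  next-fromℕ : next (fromℕ n) ≡ zero
  next-fromℕ = Fin.toℕ-injective (begin
    toℕ (next (fromℕ n))              ≡⟨ toℕ-next (fromℕ n) ⟩
    suc (toℕ (fromℕ n)) % suc n       ≡⟨ cong (λ x → suc x % suc n) (Fin.toℕ-fromℕ n) ⟩
    suc n % suc n                     ≡⟨ n%n≡0 (suc n) ⟩
    0                                 ∎)
    where open ≡-Reasoning

  prev : Fin (suc n) → Fin (suc n)
  prev = next^ n

  next-prev : ∀ i → next (prev i) ≡ i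
  next-prev = next^-n

  prev-next : ∀ i → prev (next i) ≡ i
  prev-next i = trans (next^-next n i) (next^-n i)

  next-injective : ∀ {i j : Fin (suc n)} → next i ≡ next j → i ≡ j
  next-injective {i} {j} eq = trans (sym (prev-next i)) (trans (cong prev eq) (prev-next j))

  next^-injective : ∀ d {i j : Fin (suc n)} → next^ d i ≡ next^ d j → i ≡ j
  next^-injective zero    eq = eq
  next^-injective (suc d) eq = next^-injective d (next-injective eq)

  next^-zero : ∀ {d} (d≤n : d ≤ n) → toℕ (next^ d (zero {n})) ≡ d
  next^-zero {d} d≤n = trans (toℕ-next^ d zero)
    (trans (cong (_% suc n) (ℕ.+-identityʳ d)) (m<n⇒m%n≡m (s≤s d≤n)))

  -- Powers of `next` commute and are injective, so writing `i` as `next^ e zero` reduces the claim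
  -- to `zero`, where the position can be read off.
  next^-≢ : ∀ d (i : Fin (suc n)) → 0 < d → d ≤ n → next^ d i ≢ i
  next^-≢ d i 0<d d≤n eq with next^-reach zero i
  ... | e , refl = ℕ.<⇒≢ 0<d (sym (trans (sym (next^-zero d≤n)) (cong toℕ (next^-injective e (begin
    next^ e (next^ d zero)  ≡⟨ next^-+ e d zero ⟩
    next^ (e + d) zero      ≡⟨ cong (λ x → next^ x zero) (ℕ.+-comm e d) ⟩
    next^ (d + e) zero      ≡⟨ next^-+ d e zero ⟨
    next^ d (next^ e zero)  ≡⟨ eq ⟩
    next^ e zero            ∎)))))
    where open ≡-Reasoning

  next^-distinct : ∀ {a b} (i : Fin (suc n)) → a < b → b ≤ n → next^ a i ≢ next^ b i
  next^-distinct {a} {b} i a<b b≤n eq =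
    next^-≢ (b ∸ a) (next^ a i) (ℕ.m<n⇒0<n∸m a<b) (ℕ.≤-trans (ℕ.m∸n≤m b a) b≤n)
      (trans (next^-+ (b ∸ a) a i) (trans (cong (λ x → next^ x i) (ℕ.m∸n+n≡m (ℕ.<⇒≤ a<b))) (sym eq)))

-- Rooted forests from parent functions

argmax : ∀ {n} (f : Fin (suc n) → ℕ) → ∃ λ i → ∀ j → f j ≤ f i
argmax {zero}  f = zero , λ { zero → ℕ.≤-refl }
argmax {suc n} f with argmax (f ∘ suc)
... | i , max with ℕ.≤-total (f zero) (f (suc i))
...   | inj₁ f₀≤ = suc i , λ { zero → f₀≤ ; (suc j) → max j }
...   | inj₂ ≤f₀ = zero  , λ { zero → ℕ.≤-refl ; (suc j) → ℕ.≤-trans (max j) ≤f₀ }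

module _ (G : Graph) where
  open Graph G

  Adjacent-sym : ∀ {H u v} → Adjacent G H u v → Adjacent G H v u
  Adjacent-sym (e , e∈ , j) = e , e∈ , Sum.swap j

  Connected-sym : ∀ {H u v} → Connected G H u v → Connected G H v u
  Connected-sym = Star.reverse Adjacent-sym

  closed⇒connected : ∀ {H} (P : Vertex → Set) → (∀ {u v} → P u → Adjacent G H u v → P v) →
                     ∀ {u v} → P u → Connected G H u v → P v
  closed⇒connected P closed p ε       = p
  closed⇒connected P closed p (a ◅ c) = closed⇒connected P closed (closed p a) c

  module Parents {H : SpanningSubgraph G} {S : Subset order} (Parent : Vertex → Vertex → Set) where

    -- The last index is the length of the chain of parents. As it is unique, it serves as a depth
    -- that drops strictly from child to parent, which is what excludes cycles.
    data Ascends : Vertex → Vertex → ℕ → Set where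
      here : ∀ {s} → s ∈ S → Ascends s s 0
      up   : ∀ {v u s d} → Parent v u → Ascends u s d → Ascends v s (suc d)

    module _ (functional : ∀ {v u u′} → Parent v u → Parent v u′ → u ≡ u′)
             (orphan     : ∀ {s u} → s ∈ S → ¬ Parent s u)
             (parent⇒adj : ∀ {v u} → Parent v u → Adjacent G H v u)
             (adj⇒parent : ∀ {u v} → Adjacent G H u v → Parent u v ⊎ Parent v u)
      where

      ascends-unique : ∀ {v s s′ d d′} → Ascends v s d → Ascends v s′ d′ → s ≡ s′ × d ≡ d′
      ascends-unique (here _)  (here _)   = refl , refl
      ascends-unique (here s∈) (up p _)   = contradiction p (orphan s∈)
      ascends-unique (up p _)  (here s∈)  = contradiction p (orphan s∈)
      ascends-unique (up p a)  (up p′ a′) with functional p p′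
      ... | refl with ascends-unique a a′
      ...   | refl , refl = refl , refl

      ascends⇒connected : ∀ {v s d} → Ascends v s d → Connected G H v s
      ascends⇒connected (here _) = ε
      ascends⇒connected (up p a) = parent⇒adj p ◅ ascends⇒connected a

      ascends-root : ∀ {v s d} → Ascends v s d → s ∈ S
      ascends-root (here s∈) = s∈
      ascends-root (up _ a)  = ascends-root a

      -- Each edge joins a child to its parent, and these have the same root; hence the root is
      -- constant on components and unique in each.
      connected⇒ascends : ∀ {u v s} → Connected G H u v → ∃ (Ascends u s) → ∃ (Ascends v s)
      connected⇒ascends {s = s} = flip (closed⇒connected (λ v → ∃ (Ascends v s)) step)
        where
        step : ∀ {u v} → ∃ (Ascends u s) → Adjacent G H u v → ∃ (Ascends v s)
        step (_ , a) adj with adj⇒parent adj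
        ... | inj₂ p = _ , up p a
        step (_ , here s∈) adj | inj₁ p = contradiction p (orphan s∈)
        step (_ , up p′ a) adj | inj₁ p with functional p p′
        ... | refl = _ , a

      module _ (ascends : ∀ v → ∃ λ s → ∃ (Ascends v s)) where

        private
          depth : Vertex → ℕ
          depth v = proj₁ (proj₂ (ascends v))

          parent-depth : ∀ {v u} → Parent v u → depth u < depth v
          parent-depth {v} {u} p = ℕ.≤-reflexive (sym (proj₂
            (ascends-unique (proj₂ (proj₂ (ascends v))) (up p (proj₂ (proj₂ (ascends u)))))))

          -- In a cycle, both neighbours of a deepest vertex are its parent.
          acyclic : Acyclic G H
          acyclic (k , c , unique , adj) = next^-≢ 2 j (s≤s z≤n) (s≤s (s≤s z≤n))
            (trans (cong next (next-prev i)) next-i≡j)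
            where
            m = argmax (depth ∘ lookup c)
            i = proj₁ m
            j = prev i
            upward : ∀ {l} → Adjacent G H (lookup c i) (lookup c l) → Parent (lookup c i) (lookup c l)
            upward {l} a with adj⇒parent a
            ... | inj₁ p = p
            ... | inj₂ p = contradiction (parent-depth p) (ℕ.≤⇒≯ (proj₂ m l))
            next-i≡j : next i ≡ j
            next-i≡j = VecUnique.lookup-injective unique _ _ (functional (upward (adj i))
              (upward (Adjacent-sym (subst (Adjacent G H (lookup c j) ∘ lookup c) (next-prev i) (adj j)))))

        parents⇒forest : IsRootedSpanningForest G S H
        parents⇒forest = rootedForest acyclic λ v →
          let s , _ , a = ascends v in
          s , (ascends-root a , ascends⇒connected a) , λ { {s′} (s′∈ , c) →
            proj₁ (ascends-unique (proj₂ (connected⇒ascends c (_ , a))) (here s′∈)) }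

module _ {n} {P : Fin n → Set} (P? : Decidable P) where

  comprehension : Subset n
  comprehension = tabulate (does ∘ P?)

  ∈-comprehension⁺ : ∀ {i} → P i → i ∈ comprehension
  ∈-comprehension⁺ {i} p =
    lookup⇒[]= i _ (trans (lookup∘tabulate (does ∘ P?) i) (dec-true (P? i) p))

  ∈-comprehension⁻ : ∀ {i} → i ∈ comprehension → P i
  ∈-comprehension⁻ {i} i∈ with P? i | trans (sym (lookup∘tabulate (does ∘ P?) i)) ([]=⇒lookup i∈)
  ... | yes p | _ = p

-- Forests of the wheel as cyclic words

-- A letter tells how a rim vertex is linked to the root of its component: it is
-- itself a root, or its parent is the centre, the previous or the next rim vertex.
data Letter : Set where
  ρ κ ◂ ▸ : Letter

_≟ᴸ_ : DecidableEquality Letter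
ρ ≟ᴸ ρ = yes refl
ρ ≟ᴸ κ = no λ ()
ρ ≟ᴸ ◂ = no λ ()
ρ ≟ᴸ ▸ = no λ ()
κ ≟ᴸ ρ = no λ ()
κ ≟ᴸ κ = yes refl
κ ≟ᴸ ◂ = no λ ()
κ ≟ᴸ ▸ = no λ ()
◂ ≟ᴸ ρ = no λ ()
◂ ≟ᴸ κ = no λ ()
◂ ≟ᴸ ◂ = yes refl
◂ ≟ᴸ ▸ = no λ ()
▸ ≟ᴸ ρ = no λ ()
▸ ≟ᴸ κ = no λ ()
▸ ≟ᴸ ◂ = no λ ()
▸ ≟ᴸ ▸ = yes refl

Word : ℕ → Set
Word = Vec Letter

-- The letters at which every chain of arrows stops. A good word without them is ▸ ⋯ ▸ or ◂ ⋯ ◂: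
-- both use all rim edges, so they give a cycle and cannot be told apart by their edges.
data Token : Letter → Set where
  ρ : Token ρ
  κ : Token κ

token? : Decidable Token
token? ρ = yes ρ
token? κ = yes κ
token? ◂ = no λ ()
token? ▸ = no λ ()

Good : ∀ {n} → Word (suc n) → Set
Good w = ∀ i → lookup w i ≡ ▸ → lookup w (next i) ≢ ◂

roots : ∀ {n} → Word n → Subset n
roots w = comprehension (λ i → lookup w i ≟ᴸ ρ)

module Wheel (k : ℕ) (3≤N : 3 ≤ 3 + k) where

  N : ℕ
  N = 3 + k

  W : Graph
  W = wheel N 3≤N

  open Graph W using (Vertex)

  Uses : Word N → Fin N ⊎ Fin N → Set
  Uses w (inj₁ i) = lookup w i ≡ ▸ ⊎ lookup w (next i) ≡ ◂
  Uses w (inj₂ i) = lookup w i ≡ κ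

  uses? : ∀ w → Decidable (Uses w)
  uses? w (inj₁ i) = (lookup w i ≟ᴸ ▸) ⊎-dec (lookup w (next i) ≟ᴸ ◂)
  uses? w (inj₂ i) = lookup w i ≟ᴸ κ

  edges : Word N → SpanningSubgraph W
  edges w = comprehension (uses? w ∘ splitAt N)

  Has : SpanningSubgraph W → Fin N ⊎ Fin N → Set
  Has H x = join N N x ∈ H

  has⁺ : ∀ {w} x → Uses w x → Has (edges w) x
  has⁺ {w} x u = ∈-comprehension⁺ (uses? w ∘ splitAt N) (subst (Uses w) (sym (Fin.splitAt-join N N x)) u)

  has⁻ : ∀ {w} x → Has (edges w) x → Uses w x
  has⁻ {w} x h = subst (Uses w) (Fin.splitAt-join N N x) (∈-comprehension⁻ (uses? w ∘ splitAt N) h)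

  data Link (P : Fin N ⊎ Fin N → Set) : Vertex → Vertex → Set where
    rim→   : ∀ {i} → P (inj₁ i) → Link P (suc i) (suc (next i))
    rim←   : ∀ {i} → P (inj₁ i) → Link P (suc (next i)) (suc i)
    spoke→ : ∀ {i} → P (inj₂ i) → Link P zero (suc i)
    spoke← : ∀ {i} → P (inj₂ i) → Link P (suc i) zero

  adjacent⇒link : ∀ {H u v} → Adjacent W H u v → Link (Has H) u v
  adjacent⇒link {H} (e , e∈ , j) with splitAt N e | subst (_∈ H) (sym (Fin.join-splitAt N N e)) e∈
  adjacent⇒link (e , e∈ , inj₁ refl) | inj₁ i | h = rim→ h
  adjacent⇒link (e , e∈ , inj₂ refl) | inj₁ i | h = rim← h
  adjacent⇒link (e , e∈ , inj₁ refl) | inj₂ i | h = spoke→ h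
  adjacent⇒link (e , e∈ , inj₂ refl) | inj₂ i | h = spoke← h

  private
    ends-join : ∀ x → Graph.ends W (join N N x) ≡ wheelEnds N x
    ends-join x = cong (wheelEnds N) (Fin.splitAt-join N N x)

  link⇒adjacent : ∀ {H u v} → Link (Has H) u v → Adjacent W H u v
  link⇒adjacent (rim→ h)   = _ , h , inj₁ (ends-join (inj₁ _))
  link⇒adjacent (rim← h)   = _ , h , inj₂ (ends-join (inj₁ _))
  link⇒adjacent (spoke→ h) = _ , h , inj₁ (ends-join (inj₂ _))
  link⇒adjacent (spoke← h) = _ , h , inj₂ (ends-join (inj₂ _))

  module _ (w : Word N) where

    data Parent : Vertex → Vertex → Set where
      κ↑ : ∀ {i} → lookup w i ≡ κ → Parent (suc i) zero
      ▸↑ : ∀ {i} → lookup w i ≡ ▸ → Parent (suc i) (suc (next i))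
      ◂↑ : ∀ {i j} → j ≡ next i → lookup w j ≡ ◂ → Parent (suc j) (suc i)

    parent-functional : ∀ {v u u′} → Parent v u → Parent v u′ → u ≡ u′
    parent-functional (κ↑ p)   (κ↑ q)   = refl
    parent-functional (▸↑ p)   (▸↑ q)   = refl
    parent-functional (◂↑ e p) (◂↑ f q) = cong suc (next-injective (trans (sym e) f))
    parent-functional (κ↑ p)   (▸↑ q)   = case trans (sym p) q of λ ()
    parent-functional (κ↑ p)   (◂↑ f q) = case trans (sym p) q of λ ()
    parent-functional (▸↑ p)   (κ↑ q)   = case trans (sym p) q of λ ()
    parent-functional (▸↑ p)   (◂↑ f q) = case trans (sym p) q of λ ()
    parent-functional (◂↑ e p) (κ↑ q)   = case trans (sym p) q of λ ()
    parent-functional (◂↑ e p) (▸↑ q)   = case trans (sym p) q of λ ()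

    parent-orphan : ∀ {s u} → s ∈ c∪rim (roots w) → ¬ Parent s u
    parent-orphan (there s∈) p with ∈-comprehension⁻ (λ i → lookup w i ≟ᴸ ρ) s∈
    parent-orphan (there s∈) (κ↑ p)   | q = case trans (sym p) q of λ ()
    parent-orphan (there s∈) (▸↑ p)   | q = case trans (sym p) q of λ ()
    parent-orphan (there s∈) (◂↑ e p) | q = case trans (sym p) q of λ ()

    parent⇒adjacent : ∀ {v u} → Parent v u → Adjacent W (edges w) v u
    parent⇒adjacent (κ↑ {i} p)       = link⇒adjacent (spoke← (has⁺ {w} (inj₂ i) p))
    parent⇒adjacent (▸↑ {i} p)       = link⇒adjacent (rim→ (has⁺ {w} (inj₁ i) (inj₁ p)))
    parent⇒adjacent (◂↑ {i} refl p) = link⇒adjacent (rim← (has⁺ {w} (inj₁ i) (inj₂ p)))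

    adjacent⇒parent : ∀ {u v} → Adjacent W (edges w) u v → Parent u v ⊎ Parent v u
    adjacent⇒parent a with adjacent⇒link a
    ... | spoke→ {i} h = inj₂ (κ↑ (has⁻ {w} (inj₂ i) h))
    ... | spoke← {i} h = inj₁ (κ↑ (has⁻ {w} (inj₂ i) h))
    ... | rim→ {i} h   = Sum.map ▸↑ (◂↑ refl) (has⁻ {w} (inj₁ i) h)
    ... | rim← {i} h   = Sum.swap (Sum.map ▸↑ (◂↑ refl) (has⁻ {w} (inj₁ i) h))

    open Parents W {edges w} {c∪rim (roots w)} Parent public

    module _ (good : Good w) {t} (token : Token (lookup w t)) where

      private
        Rooted : Fin N → Set
        Rooted i = ∃₂ (Ascends (suc i))

        ascend : ∀ {v u} → Parent v u → ∃₂ (Ascends u) → ∃₂ (Ascends v)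
        ascend p (_ , _ , a) = _ , _ , up p a

        root : ∀ {i} → lookup w i ≡ ρ → Rooted i
        root p = _ , _ , here (there (∈-comprehension⁺ (λ i → lookup w i ≟ᴸ ρ) p))

        hub : ∀ {i} → lookup w i ≡ κ → Rooted i
        hub p = ascend (κ↑ p) (_ , _ , here here)

        -- By goodness, the letter after ▸ is not ◂, so a chain of parents never turns back. The
        -- distance `d` to the token at `t` then bounds its length; `leftwards` is the mirror image.
        rightwards : ∀ d i → next^ d i ≡ t → lookup w i ≢ ◂ → Rooted i
        rightwards d i eq ≢◂ with lookup w i in p
        ... | ρ = root p
        ... | κ = hub p
        ... | ◂ = contradiction refl ≢◂
        rightwards zero    i refl ≢◂ | ▸ = case subst Token p token of λ ()
        rightwards (suc d) i eq   ≢◂ | ▸ =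
          ascend (▸↑ p) (rightwards d (next i) (trans (next^-next d i) eq) (good i p))

        leftwards : ∀ d i → next^ d t ≡ i → lookup w i ≢ ▸ → Rooted i
        leftwards d i eq ≢▸ with lookup w i in p
        ... | ρ = root p
        ... | κ = hub p
        ... | ▸ = contradiction refl ≢▸
        leftwards zero    i refl ≢▸ | ◂ = case subst Token p token of λ ()
        leftwards (suc d) i eq   ≢▸ | ◂ = ascend (◂↑ (sym eq) p) (leftwards d (next^ d t) refl
          λ q → good (next^ d t) q (trans (cong (lookup w) eq) p))

      word-ascends : ∀ v → ∃₂ (Ascends v)
      word-ascends zero    = _ , _ , here here
      word-ascends (suc i) with lookup w i ≟ᴸ ◂
      ... | no ≢◂ = let d , eq = next^-reach i t in rightwards d i eq ≢◂
      ... | yes p = let d , eq = next^-reach t i in leftwards d i eq λ q → case trans (sym p) q of λ ()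

      word⇒forest : IsRootedSpanningForest W (c∪rim (roots w)) (edges w)
      word⇒forest = parents⇒forest parent-functional parent-orphan parent⇒adjacent adjacent⇒parent word-ascends

-- Every forest comes from a word

module _ {G : Graph} {H : SpanningSubgraph G} where
  open Graph G

  roots-disconnected : ∀ {S} → IsRootedSpanningForest G S H →
                       ∀ {s s′} → s ∈ S → s′ ∈ S → Connected G H s s′ → s ≡ s′
  roots-disconnected (rootedForest _ uniqueRoot) {s} s∈ s′∈ c =
    let _ , _ , unique = uniqueRoot s in trans (sym (unique (s∈ , ε))) (unique (s′∈ , c))

  -- Acyclicity does not involve the roots, and only the component containing both `r` and `c`
  -- changes its representative. This serves in both directions between the centre and a rim vertex.
  reroot : ∀ {S S′ r c} → r ∈ S → Connected G H r c → c ∈ S′ →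
           (∀ {s} → s ∈ S → s ≢ r → s ∈ S′) → (∀ {s} → s ∈ S′ → s ≡ c ⊎ (s ∈ S × s ≢ r)) →
           IsRootedSpanningForest G S H → IsRootedSpanningForest G S′ H
  reroot {S} {S′} {r} {c} r∈S r~c c∈S′ S⇒S′ S′⇒S (rootedForest acyclic uniqueRoot) =
    rootedForest acyclic root′
    where
    root′ : ∀ v → ∃! _≡_ λ s → s ∈ S′ × Connected G H v s
    root′ v with uniqueRoot v
    ... | s , (s∈ , v~s) , unique with s Fin.≟ r
    ...   | yes refl = c , (c∈S′ , v~s ◅◅ r~c) , λ (s′∈ , v~s′) → case S′⇒S s′∈ of λ
            { (inj₁ refl) → refl ; (inj₂ (s′∈S , ≢r)) → contradiction (sym (unique (s′∈S , v~s′))) ≢r }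
    ...   | no s≢r = s , (S⇒S′ s∈ s≢r , v~s) , λ (s′∈ , v~s′) → case S′⇒S s′∈ of λ
            { (inj₁ refl) → contradiction (unique (r∈S , v~s′ ◅◅ Connected-sym G r~c)) s≢r
            ; (inj₂ (s′∈S , _)) → unique (s′∈S , v~s′) }

module Completeness (k : ℕ) (3≤N : 3 ≤ 3 + k) where
  open Wheel k 3≤N

  module _ {H : SpanningSubgraph W} where

    Run : Fin N → ℕ → Set
    Run i d = ∀ {a} → a < d → Has H (inj₁ (next^ a i))

    run-next : ∀ {i d} → Run i (suc d) → Run (next i) d
    run-next {i} run {a} a<d = subst (Has H ∘ inj₁) (sym (next^-next a i)) (run (s≤s a<d))

    run-cons : ∀ {i d} → Has H (inj₁ i) → Run (next i) d → Run i (suc d)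
    run-cons h run {zero}  _         = h
    run-cons {i} h run {suc a} (s≤s a<d) = subst (Has H ∘ inj₁) (next^-next a i) (run a<d)

    run⇒connected : ∀ d {i} → Run i d → Connected W H (suc i) (suc (next^ d i))
    run⇒connected zero    run = ε
    run⇒connected (suc d) {i} run = link⇒adjacent (rim→ (run (s≤s z≤n))) ◅
      subst (Connected W H (suc (next i)) ∘ suc) (next^-next d i) (run⇒connected d (run-next {d = d} run))

    rim-cycle : ∀ {i} → Run i N → HasCycle W H
    rim-cycle {i} run = k , tabulate suc , VecUnique.tabulate⁺ Fin.suc-injective , λ j →
      subst₂ (Adjacent W H) (sym (lookup∘tabulate suc j)) (sym (lookup∘tabulate suc (next j)))
        (link⇒adjacent (rim→ (everywhere j)))
      where
      everywhere : ∀ j → Has H (inj₁ j)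
      everywhere j = let d , eq = next^-reach i j in
        subst (Has H ∘ inj₁) (trans (next^-% d i) eq) (run (m%n<n d N))

    -- The two spokes close the run through the centre, giving a cycle of 3 + `d` vertices. The
    -- bound on `d` keeps its 2 + `d` rim vertices distinct.
    fan-cycle : ∀ {d i} → suc d < N → Run i (suc d) → Has H (inj₂ i) → Has H (inj₂ (next^ (suc d) i)) →
                HasCycle W H
    fan-cycle {d} {i} d<N run sᵢ sⱼ =
      d , zero ∷ tabulate v , VecAll.tabulate⁺ {f = v} (λ _ ()) ∷ VecUnique.tabulate⁺ v-injective , adjacent
      where
      v : Fin (2 + d) → Fin (suc N)
      v a = suc (next^ (toℕ a) i)

      v-injective : ∀ {a b} → v a ≡ v b → a ≡ b
      v-injective {a} {b} eq with ℕ.<-cmp (toℕ a) (toℕ b)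
      ... | tri≈ _ e _ = Fin.toℕ-injective e
      ... | tri< a<b _ _ = contradiction (Fin.suc-injective eq)
              (next^-distinct i a<b (ℕ.≤-pred (ℕ.≤-trans (Fin.toℕ<n b) d<N)))
      ... | tri> _ _ b<a = contradiction (Fin.suc-injective (sym eq))
              (next^-distinct i b<a (ℕ.≤-pred (ℕ.≤-trans (Fin.toℕ<n a) d<N)))

      adjacent : ∀ j → Adjacent W H (lookup (zero ∷ tabulate v) j) (lookup (zero ∷ tabulate v) (next j))
      adjacent zero = link⇒adjacent (spoke→ sᵢ)
      adjacent (suc j) with view j
      ... | ‵fromℕ = subst₂ (Adjacent W H)
              (sym (trans (lookup∘tabulate v (fromℕ (suc d))) (cong (λ x → suc (next^ x i)) (Fin.toℕ-fromℕ (suc d)))))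
              (cong (lookup (zero ∷ tabulate v)) (sym (next-fromℕ {2 + d})))
              (link⇒adjacent (spoke← sⱼ))
      ... | ‵inject₁ a = subst₂ (Adjacent W H)
              (sym (trans (lookup∘tabulate v (inject₁ a)) (cong (λ x → suc (next^ x i)) (Fin.toℕ-inject₁ a))))
              (trans (sym (lookup∘tabulate v (suc a))) (cong (lookup (zero ∷ tabulate v)) (sym (next-inject₁ (suc a)))))
              (link⇒adjacent (rim→ (run (Fin.toℕ<n a))))

  module _ {H : SpanningSubgraph W} {R : Subset N} (forest : IsRootedSpanningForest W (c∪rim R) H) where

    open IsRootedSpanningForest forest

    private
      Marked : Fin N → Set
      Marked i = i ∈ R ⊎ Has H (inj₂ i)

      Reaches : Fin N → Set
      Reaches i = ∃ λ d → d < N × (Run {H} i d × Marked (next^ d i))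

      marked? : Decidable Marked
      marked? i = (i ∈? R) ⊎-dec (_ ∈? H)

      reaches? : Decidable Reaches
      reaches? i = ℕ.anyUpTo? (λ d → ℕ.allUpTo? (λ a → _ ∈? H) d ×-dec marked? (next^ d i)) N

      -- The case ◂ records only that the search to the right fails. That the edge to the left is
      -- then present has to be derived, from the existence of a root in the component.
      data Classified (i : Fin N) : Letter → Set where
        ρ : i ∈ R → Classified i ρ
        κ : i ∉ R → Has H (inj₂ i) → Classified i κ
        ◂ : ¬ Marked i → ¬ Reaches i → Classified i ◂
        ▸ : ¬ Marked i → Reaches i → Classified i ▸

      classify : ∀ i → ∃ (Classified i)
      classify i with i ∈? R
      ... | yes i∈R = ρ , ρ i∈R
      ... | no  i∉R with join N N (inj₂ i) ∈? H
      ...   | yes s = κ , κ i∉R s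
      ...   | no ¬s with reaches? i
      ...     | yes r = ▸ , ▸ Sum.[ i∉R , ¬s ] r
      ...     | no ¬r = ◂ , ◂ Sum.[ i∉R , ¬s ] ¬r

    word : Word N
    word = tabulate (proj₁ ∘ classify)

    private
      classified : ∀ i → Classified i (lookup word i)
      classified i = subst (Classified i) (sym (lookup∘tabulate (proj₁ ∘ classify) i)) (proj₂ (classify i))

      classified′ : ∀ {i a} → lookup word i ≡ a → Classified i a
      classified′ {i} eq = subst (Classified i) eq (classified i)

      root≁hub : ∀ {i} → i ∈ R → ¬ Connected W H (suc i) zero
      root≁hub i∈R c with roots-disconnected forest (there i∈R) here c
      ... | ()

      no-full-run : ∀ {i} → ¬ Run {H} i N
      no-full-run run = acyclic (rim-cycle run)

      -- A second mark would connect two roots of `R`, connect such a root with the root `c`, or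
      -- close a cycle through `c`.
      no-double-mark : ∀ {i d} → suc d < N → Run {H} i (suc d) → Marked i → Marked (next^ (suc d) i) → ⊥
      no-double-mark {i} {d} d<N run (inj₁ i∈R) (inj₁ j∈R) =
        next^-≢ (suc d) i (s≤s z≤n) (ℕ.≤-pred d<N) (sym (Fin.suc-injective
          (roots-disconnected forest (there i∈R) (there j∈R) (run⇒connected (suc d) run))))
      no-double-mark {d = d} d<N run (inj₁ i∈R) (inj₂ sⱼ) =
        root≁hub i∈R (run⇒connected (suc d) run ◅◅ link⇒adjacent (spoke← sⱼ) ◅ ε)
      no-double-mark {d = d} d<N run (inj₂ sᵢ) (inj₁ j∈R) =
        root≁hub j∈R (Connected-sym W (run⇒connected (suc d) run) ◅◅ link⇒adjacent (spoke← sᵢ) ◅ ε)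
      no-double-mark d<N run (inj₂ sᵢ) (inj₂ sⱼ) = acyclic (fan-cycle d<N run sᵢ sⱼ)

    -- If the vertex `i` is unmarked and reaches a mark on its right, `next i` reaches the same mark
    -- in one step fewer, so it does not fall into the default case ◂.
    word-good : Good word
    word-good i p q with classified′ p | classified′ {next i} q
    ... | ▸ ¬m (zero , _ , _ , m)      | _       = ¬m m
    ... | ▸ ¬m (suc d , d<N , run , m) | ◂ _ ¬r =
      ¬r (d , ℕ.<⇒≤ d<N , (λ {a} → run-next {d = d} run {a}) , subst Marked (sym (next^-next d i)) m)

    roots-word : roots word ≡ R
    roots-word = ⊆-antisym
      (λ i∈ → case classified′ (∈-comprehension⁻ (λ i → lookup word i ≟ᴸ ρ) i∈) of λ { (ρ i∈R) → i∈R })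
      (λ {i} i∈R → ∈-comprehension⁺ (λ i → lookup word i ≟ᴸ ρ) (case classified′ {i} refl of is-ρ i∈R))
      where
      is-ρ : ∀ {i a} → i ∈ R → Classified i a → a ≡ ρ
      is-ρ i∈R (ρ _)    = refl
      is-ρ i∈R (κ i∉ _) = contradiction i∈R i∉
      is-ρ i∈R (◂ ¬m _) = contradiction (inj₁ i∈R) ¬m
      is-ρ i∈R (▸ ¬m _) = contradiction (inj₁ i∈R) ¬m

    private
      uses⇒has : ∀ x → Uses word x → Has H x
      uses⇒has (inj₂ i) p with classified′ {i} p
      ... | κ _ s = s
      uses⇒has (inj₁ i) (inj₁ p) with classified′ {i} p
      ... | ▸ ¬m (zero , _ , _ , m)  = contradiction m ¬m
      ... | ▸ ¬m (suc d , _ , run , _) = run (s≤s z≤n)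
      uses⇒has (inj₁ i) (inj₂ p) with classified′ {next i} p
      ... | ◂ _ ¬r = decidable-stable (_ ∈? H) λ ¬h → stuck ¬h (uniqueRoot (suc (next i)))
        where
        -- Without the edge before next i, the component of next i would only
        -- contain unmarked rim vertices.
        Arc : Fin (suc N) → Set
        Arc v = ∃ λ d → v ≡ suc (next^ d (next i)) × d < N × Run {H} (next i) d

        closed : ¬ Has H (inj₁ i) → ∀ {u v} → Arc u → Adjacent W H u v → Arc v
        closed ¬h (d , eq , d<N , run) adj with adjacent⇒link adj
        closed ¬h (d , () , d<N , run) adj | spoke→ s
        closed ¬h (d , refl , d<N , run) adj | spoke← s = contradiction (d , d<N , (λ {a} → run {a}) , inj₂ s) ¬r
        closed ¬h (zero , eq , d<N , run) adj | rim← h =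
          contradiction (subst (Has H ∘ inj₁) (next-injective (Fin.suc-injective eq)) h) ¬h
        closed ¬h (suc d , eq , d<N , run) adj | rim← h =
          d , cong suc (next-injective (Fin.suc-injective eq)) , ℕ.<⇒≤ d<N , λ a<d → run (ℕ.m<n⇒m<1+n a<d)
        closed ¬h (d , refl , d<N , run) adj | rim→ h with ℕ.m≤n⇒m<n∨m≡n d<N
        -- The arc has come all the way round to `i`, so the edge ahead of it is the missing one.
        ... | inj₂ refl = contradiction (subst (Has H ∘ inj₁) (prev-next i) h) ¬h
        ... | inj₁ d+1<N = suc d , refl , d+1<N , λ a<d+1 → case ℕ.m≤n⇒m<n∨m≡n (ℕ.≤-pred a<d+1) of λ
                { (inj₁ a<d) → run a<d ; (inj₂ refl) → h }

        stuck : ¬ Has H (inj₁ i) → ∃! _≡_ (λ s → s ∈ c∪rim R × Connected W H (suc (next i)) s) → ⊥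
        -- The root of the component of `next i` would lie on the arc. The centre does not, and a
        -- root in `R` there is a mark that `next i` reaches.
        stuck ¬h (s , (s∈ , c) , _)
          with closed⇒connected W Arc (closed ¬h) (0 , refl , s≤s z≤n , λ ()) c
        stuck ¬h (_ , (there s∈ , c) , _) | d , refl , d<N , run =
          ¬r (d , d<N , (λ {a} → run {a}) , inj₁ s∈)

      -- For a rim edge used by neither end, `next i` still reaches a mark on its right. Prefixing
      -- the edge gives a full rim cycle, a second mark at `i` on the same run, or a mark that `i`
      -- reaches, so that its letter is ▸ after all.
      has⇒uses : ∀ x → Has H x → Uses word x
      has⇒uses (inj₂ i) s with lookup word i | classified i
      ... | _ | ρ i∈R  = contradiction (link⇒adjacent (spoke← s) ◅ ε) (root≁hub i∈R)
      ... | _ | κ _ _  = refl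
      ... | _ | ◂ ¬m _ = contradiction (inj₂ s) ¬m
      ... | _ | ▸ ¬m _ = contradiction (inj₂ s) ¬m
      has⇒uses (inj₁ i) h with lookup word i ≟ᴸ ▸ | lookup word (next i) ≟ᴸ ◂
      ... | yes p | _     = inj₁ p
      ... | _     | yes q = inj₂ q
      ... | no ≢▸ | no ≢◂ = contradiction (reaches-next ≢◂) blocked
        where
        reaches-next : lookup word (next i) ≢ ◂ → Reaches (next i)
        reaches-next ≢◂ with lookup word (next i) | classified (next i)
        ... | _ | ρ j∈R  = 0 , s≤s z≤n , (λ ()) , inj₁ j∈R
        ... | _ | κ _ s  = 0 , s≤s z≤n , (λ ()) , inj₂ s
        ... | _ | ◂ _ _  = contradiction refl ≢◂
        ... | _ | ▸ _ r  = r

        blocked : ¬ Reaches (next i)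
        blocked (d , d<N , run , m) with ℕ.m≤n⇒m<n∨m≡n d<N
        ... | inj₂ refl = no-full-run {i} λ {a} → run-cons {d = d} h run {a}
        ... | inj₁ d+1<N with marked? i
        ...   | yes mᵢ = no-double-mark d+1<N (λ {a} → run-cons {d = d} h run {a}) mᵢ
                           (subst Marked (next^-next d i) m)
        ...   | no ¬mᵢ with lookup word i | classified i
        ...     | _ | ρ i∈R  = ¬mᵢ (inj₁ i∈R)
        ...     | _ | κ _ s  = ¬mᵢ (inj₂ s)
        ...     | _ | ◂ _ ¬r = ¬r (suc d , d+1<N , (λ {a} → run-cons {d = d} h run {a}) , subst Marked (next^-next d i) m)
        ...     | _ | ▸ _ _  = ≢▸ refl

    edges-word : edges word ≡ H
    edges-word = ⊆-antisym
      (λ {e} e∈ → subst (_∈ H) (Fin.join-splitAt N N e)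
        (uses⇒has (splitAt N e) (has⁻ {word} (splitAt N e) (subst (_∈ edges word) (sym (Fin.join-splitAt N N e)) e∈))))
      (λ {e} e∈ → subst (_∈ edges word) (Fin.join-splitAt N N e)
        (has⁺ {word} (splitAt N e) (has⇒uses (splitAt N e) (subst (_∈ H) (sym (Fin.join-splitAt N N e)) e∈))))

-- Bijective counting

module _ {A B : Set} where

  map-unique : ∀ {f : A → B} {xs} → (∀ {x y} → x List.∈ xs → y List.∈ xs → f x ≡ f y → x ≡ y) →
               List.Unique xs → List.Unique (List.map f xs)
  map-unique inj []         = []
  map-unique inj (x∉ ∷ xs!) =
    All.map⁺ (All.tabulate λ y∈ eq → All.lookup x∉ y∈ (inj (here refl) (there y∈) eq))
      ∷ map-unique (λ x∈ y∈ → inj (there x∈) (there y∈)) xs!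

  length-bijection : ∀ {xs : List A} {ys : List B} (f : A → B) → List.Unique xs → List.Unique ys →
                     (∀ {x} → x List.∈ xs → f x List.∈ ys) →
                     (∀ {x y} → x List.∈ xs → y List.∈ xs → f x ≡ f y → x ≡ y) →
                     (∀ {y} → y List.∈ ys → ∃ λ x → x List.∈ xs × f x ≡ y) →
                     length xs ≡ length ys
  length-bijection {xs} f xs! ys! into inj onto = trans (sym (List.length-map f xs))
    (↭-length (∼bag⇒↭ (unique∧set⇒bag (map-unique inj xs!) ys! (mk⇔
      (λ y∈ → let _ , x∈ , eq = ∈-map⁻ f y∈ in subst (List._∈ _) (sym eq) (into x∈))
      (λ y∈ → let _ , x∈ , eq = onto y∈ in subst (List._∈ _) eq (∈-map⁺ f x∈))))))

-- Opaque, so that the type checker never runs a decision procedure on a list of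
-- known length.
opaque
  count : ∀ {A : Set} {P : A → Set} → Decidable P → List A → ℕ
  count P? xs = length (filter P? xs)

module _ {A B : Set} {P : A → Set} {Q : B → Set} (P? : Decidable P) (Q? : Decidable Q) where opaque
  unfolding count

  count-bijection :
    ∀ {xs ys} → List.Unique xs → List.Unique ys → (∀ x → x List.∈ xs) → (∀ y → y List.∈ ys) → (f : A → B) →
    (∀ {x} → P x → Q (f x)) → (∀ {x y} → P x → P y → f x ≡ f y → x ≡ y) → (∀ {y} → Q y → ∃ λ x → P x × f x ≡ y) →
    count P? xs ≡ count Q? ys
  count-bijection {xs} {ys} xs! ys! ∈xs ∈ys f into inj onto =
    length-bijection f (Unique.filter⁺ P? xs!) (Unique.filter⁺ Q? ys!)
      (λ {x} x∈ → ∈-filter⁺ Q? (∈ys (f x)) (into (∈⁻ x∈)))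
      (λ x∈ y∈ → inj (∈⁻ x∈) (∈⁻ y∈))
      λ y∈ → let x , p , eq = onto (proj₂ (∈-filter⁻ Q? {xs = ys} y∈)) in x , ∈-filter⁺ P? (∈xs x) p , eq
    where
    ∈⁻ : ∀ {x} → x List.∈ filter P? xs → P x
    ∈⁻ = proj₂ ∘ ∈-filter⁻ P? {xs = xs}

module _ {A : Set} {P : A → Set} (P? : Decidable P) where opaque
  unfolding count

  count-++ : ∀ xs ys → count P? (xs ++ ys) ≡ count P? xs + count P? ys
  count-++ xs ys = trans (cong length (List.filter-++ P? xs ys)) (List.length-++ (filter P? xs))

  count-map : ∀ {B : Set} (f : B → A) xs → count P? (List.map f xs) ≡ count (P? ∘ f) xs
  count-map f []       = refl
  count-map f (x ∷ xs) with P? (f x)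
  ... | yes _ = cong suc (count-map f xs)
  ... | no  _ = count-map f xs

  count-none : (∀ x → ¬ P x) → ∀ xs → count P? xs ≡ 0
  count-none ¬p []       = refl
  count-none ¬p (x ∷ xs) with P? x
  ... | yes p = contradiction p (¬p x)
  ... | no  _ = count-none ¬p xs

  count-cong : ∀ {Q : A → Set} (Q? : Decidable Q) → (∀ {x} → P x → Q x) → (∀ {x} → Q x → P x) →
               ∀ xs → count P? xs ≡ count Q? xs
  count-cong Q? P⇒Q Q⇒P []       = refl
  count-cong Q? P⇒Q Q⇒P (x ∷ xs) with P? x | Q? x
  ... | yes _ | yes _ = cong suc (count-cong Q? P⇒Q Q⇒P xs)
  ... | no  _ | no  _ = count-cong Q? P⇒Q Q⇒P xs
  ... | yes p | no ¬q = contradiction (P⇒Q p) ¬q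
  ... | no ¬p | yes q = contradiction (Q⇒P q) ¬p

module _ {A B : Set} {P : A × B → Set} (P? : Decidable P) where opaque
  unfolding count

  count-cartesianProduct : ∀ xs ys → count P? (cartesianProduct xs ys) ≡
    ListAction.sum (List.map (λ x → count (λ y → P? (x , y)) ys) xs)
  count-cartesianProduct []       ys = refl
  count-cartesianProduct (x ∷ xs) ys = trans (count-++ P? (List.map (x ,_) ys) (cartesianProduct xs ys))
    (cong₂ _+_ (count-map P? (x ,_) ys) (count-cartesianProduct xs ys))

sum-filter : ∀ {A : Set} {P : A → Set} (P? : Decidable P) (f g : A → ℕ) →
             (∀ {x} → P x → f x ≡ g x) → (∀ {x} → ¬ P x → f x ≡ 0) →
             ∀ xs → ListAction.sum (List.map f xs) ≡ ListAction.sum (List.map g (filter P? xs))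
sum-filter P? f g f≡g f≡0 []       = refl
sum-filter P? f g f≡g f≡0 (x ∷ xs) with P? x
... | yes p = cong₂ _+_ (f≡g p) (sum-filter P? f g f≡g f≡0 xs)
... | no ¬p = cong₂ _+_ (f≡0 ¬p) (sum-filter P? f g f≡g f≡0 xs)

sum-const : ∀ {A : Set} (f : A → ℕ) c xs → (∀ x → f x ≡ c) → ListAction.sum (List.map f xs) ≡ length xs * c
sum-const f c []       eq = refl
sum-const f c (x ∷ xs) eq = cong₂ _+_ (eq x) (sum-const f c xs eq)

∈-subsets : ∀ {n} (S : Subset n) → S List.∈ subsets n
∈-subsets []            = here refl
∈-subsets (inside ∷ S)  = ∈-++⁺ˡ (∈-map⁺ (inside ∷_) (∈-subsets S))
∈-subsets {suc n} (outside ∷ S) = ∈-++⁺ʳ (List.map (inside ∷_) (subsets n)) (∈-map⁺ (outside ∷_) (∈-subsets S))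

subsets-unique : ∀ n → List.Unique (subsets n)
subsets-unique zero    = All.[] ∷ []
subsets-unique (suc n) = Unique.++⁺
  (Unique.map⁺ (proj₂ ∘ ∷-injective) (subsets-unique n))
  (Unique.map⁺ (proj₂ ∘ ∷-injective) (subsets-unique n))
  λ (p , q) → case trans (sym (proj₂ (proj₂ (∈-map⁻ (inside ∷_) p)))) (proj₂ (proj₂ (∈-map⁻ (outside ∷_) q))) of λ ()

letters : List Letter
letters = ρ ∷ κ ∷ ◂ ∷ ▸ ∷ []

words : ∀ n → List (Word n)
words zero    = [] ∷ []
words (suc n) = cartesianProductWith _∷_ letters (words n)

∈-letters : ∀ a → a List.∈ letters
∈-letters ρ = here refl
∈-letters κ = there (here refl)
∈-letters ◂ = there (there (here refl))
∈-letters ▸ = there (there (there (here refl)))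

letters-unique : List.Unique letters
letters-unique = ((λ ()) All.∷ (λ ()) All.∷ (λ ()) All.∷ All.[])
               ∷ ((λ ()) All.∷ (λ ()) All.∷ All.[]) ∷ ((λ ()) All.∷ All.[]) ∷ All.[] ∷ []

∈-words : ∀ {n} (w : Word n) → w List.∈ words n
∈-words []      = here refl
∈-words (a ∷ w) = ∈-cartesianProductWith⁺ _∷_ (∈-letters a) (∈-words w)

words-unique : ∀ n → List.Unique (words n)
words-unique zero    = All.[] ∷ []
words-unique (suc n) = Unique.cartesianProductWith⁺ _∷_ ∷-injective letters-unique (words-unique n)

∣[]≔inside∣ : ∀ {n} (S : Subset n) i → lookup S i ≡ outside → ∣ S [ i ]≔ inside ∣ ≡ suc ∣ S ∣
∣[]≔inside∣ (outside ∷ S) zero    _  = refl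
∣[]≔inside∣ (inside  ∷ S) (suc i) eq = cong suc (∣[]≔inside∣ S i eq)
∣[]≔inside∣ (outside ∷ S) (suc i) eq = ∣[]≔inside∣ S i eq

-- Rotation of cyclic words

∣roots-∷ʳ∣ : ∀ {n} a (w : Word n) → ∣ roots (w ∷ʳ a) ∣ ≡ ∣ roots (a ∷ w) ∣
∣roots-∷ʳ∣ a []      = refl
∣roots-∷ʳ∣ ρ (ρ ∷ w) = cong suc (∣roots-∷ʳ∣ ρ w)
∣roots-∷ʳ∣ κ (ρ ∷ w) = cong suc (∣roots-∷ʳ∣ κ w)
∣roots-∷ʳ∣ ◂ (ρ ∷ w) = cong suc (∣roots-∷ʳ∣ ◂ w)
∣roots-∷ʳ∣ ▸ (ρ ∷ w) = cong suc (∣roots-∷ʳ∣ ▸ w)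
∣roots-∷ʳ∣ ρ (κ ∷ w) = ∣roots-∷ʳ∣ ρ w
∣roots-∷ʳ∣ κ (κ ∷ w) = ∣roots-∷ʳ∣ κ w
∣roots-∷ʳ∣ ◂ (κ ∷ w) = ∣roots-∷ʳ∣ ◂ w
∣roots-∷ʳ∣ ▸ (κ ∷ w) = ∣roots-∷ʳ∣ ▸ w
∣roots-∷ʳ∣ ρ (◂ ∷ w) = ∣roots-∷ʳ∣ ρ w
∣roots-∷ʳ∣ κ (◂ ∷ w) = ∣roots-∷ʳ∣ κ w
∣roots-∷ʳ∣ ◂ (◂ ∷ w) = ∣roots-∷ʳ∣ ◂ w
∣roots-∷ʳ∣ ▸ (◂ ∷ w) = ∣roots-∷ʳ∣ ▸ w
∣roots-∷ʳ∣ ρ (▸ ∷ w) = ∣roots-∷ʳ∣ ρ w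
∣roots-∷ʳ∣ κ (▸ ∷ w) = ∣roots-∷ʳ∣ κ w
∣roots-∷ʳ∣ ◂ (▸ ∷ w) = ∣roots-∷ʳ∣ ◂ w
∣roots-∷ʳ∣ ▸ (▸ ∷ w) = ∣roots-∷ʳ∣ ▸ w

lookup-∷ʳ-inject₁ : ∀ {A : Set} {n} (w : Vec A n) a i → lookup (w ∷ʳ a) (inject₁ i) ≡ lookup w i
lookup-∷ʳ-inject₁ (_ ∷ w) a zero    = refl
lookup-∷ʳ-inject₁ (_ ∷ w) a (suc i) = lookup-∷ʳ-inject₁ w a i

lookup-∷ʳ-fromℕ : ∀ {A : Set} {n} (w : Vec A n) a → lookup (w ∷ʳ a) (fromℕ n) ≡ a
lookup-∷ʳ-fromℕ []      a = refl
lookup-∷ʳ-fromℕ (_ ∷ w) a = lookup-∷ʳ-fromℕ w a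

rotate : ∀ {n} → Word (suc n) → Word (suc n)
rotate (a ∷ w) = w ∷ʳ a

lookup-rotate : ∀ {n} (w : Word (suc n)) i → lookup (rotate w) i ≡ lookup w (next i)
lookup-rotate (a ∷ w) i with view i
... | ‵fromℕ     = trans (lookup-∷ʳ-fromℕ w a) (cong (lookup (a ∷ w)) (sym next-fromℕ))
... | ‵inject₁ j = trans (lookup-∷ʳ-inject₁ w a j) (cong (lookup (a ∷ w)) (sym (next-inject₁ j)))

rotate-injective : ∀ {n} {v w : Word (suc n)} → rotate v ≡ rotate w → v ≡ w
rotate-injective {v = a ∷ v} {b ∷ w} eq with ∷ʳ-injective v w eq
... | refl , refl = refl

rotate-surjective : ∀ {n} (w : Word (suc n)) → ∃ λ v → rotate v ≡ w
rotate-surjective w with initLast w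
... | v , a , refl = a ∷ v , refl

∣roots-rotate∣ : ∀ {n} (w : Word (suc n)) → ∣ roots (rotate w) ∣ ≡ ∣ roots w ∣
∣roots-rotate∣ (a ∷ w) = ∣roots-∷ʳ∣ a w

good-rotate⁺ : ∀ {n} (w : Word (suc n)) → Good w → Good (rotate w)
good-rotate⁺ w good i p q =
  good (next i) (trans (sym (lookup-rotate w i)) p) (trans (sym (lookup-rotate w (next i))) q)

good-rotate⁻ : ∀ {n} (w : Word (suc n)) → Good (rotate w) → Good w
good-rotate⁻ w good i p q = good (prev i)
  (trans (lookup-rotate w (prev i)) (trans (cong (lookup w) (next-prev i)) p))
  (trans (lookup-rotate w (next (prev i))) (trans (cong (lookup w ∘ next) (next-prev i)) q))

good? : ∀ {n} → Decidable (Good {n})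
good? w = Fin.all? λ i → (lookup w i ≟ᴸ ▸) →-dec ¬? (lookup w (next i) ≟ᴸ ◂)

-- The chain of parents starting at i leads to the centre.
data ToHub {n} (w : Word (suc n)) : Fin (suc n) → Set where
  hub   : ∀ {i} → lookup w i ≡ κ → ToHub w i
  right : ∀ {i} → lookup w i ≡ ▸ → ToHub w (next i) → ToHub w i
  left  : ∀ {i j} → j ≡ next i → lookup w j ≡ ◂ → ToHub w i → ToHub w j

toHub-κ : ∀ {n} {w : Word (suc n)} {i} → ToHub w i → ∃ λ t → lookup w t ≡ κ
toHub-κ (hub p)      = _ , p
toHub-κ (right _ h)  = toHub-κ h
toHub-κ (left _ _ h) = toHub-κ h

toHub-≢ρ : ∀ {n} {w : Word (suc n)} {i} → ToHub w i → lookup w i ≢ ρ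
toHub-≢ρ (hub p)      q = case trans (sym p) q of λ ()
toHub-≢ρ (right p _)  q = case trans (sym p) q of λ ()
toHub-≢ρ (left _ p _) q = case trans (sym p) q of λ ()

toHub-rotate⁺ : ∀ {n} {w : Word (suc n)} {i j} → j ≡ next i → ToHub w j → ToHub (rotate w) i
toHub-rotate⁺ {w = w} {i} refl (hub p)      = hub (trans (lookup-rotate w i) p)
toHub-rotate⁺ {w = w} {i} refl (right p h)  = right (trans (lookup-rotate w i) p) (toHub-rotate⁺ refl h)
toHub-rotate⁺ {w = w} {i} refl (left {i′} e p h) =
  left (trans (next-injective e) (sym (next-prev i′))) (trans (lookup-rotate w i) p)
    (toHub-rotate⁺ (sym (next-prev i′)) h)

toHub-rotate⁻ : ∀ {n} {w : Word (suc n)} {i} → ToHub (rotate w) i → ToHub w (next i)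
toHub-rotate⁻ {w = w} {i} (hub p)        = hub (trans (sym (lookup-rotate w i)) p)
toHub-rotate⁻ {w = w} {i} (right p h)    = right (trans (sym (lookup-rotate w i)) p) (toHub-rotate⁻ h)
toHub-rotate⁻ {w = w} {i} (left refl p h) = left refl (trans (sym (lookup-rotate w i)) p) (toHub-rotate⁻ h)

-- The sums over root sets as numbers of pairs of a root set and a forest

module RimForests (N : ℕ) (3≤N : 3 ≤ N) where

  private
    W = wheel N 3≤N

  RootedForest : (Subset N → Subset (suc N)) → ℕ → Subset N × SpanningSubgraph W → Set
  RootedForest f r (R , H) = ∣ R ∣ ≡ r × IsRootedSpanningForest W (f R) H

  rootedForest? : ∀ f r → Decidable (RootedForest f r)
  rootedForest? f r (R , H) = (∣ R ∣ ℕ.≟ r) ×-dec isRootedSpanningForest? W (f R) H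

  pairs : List (Subset N × SpanningSubgraph W)
  pairs = cartesianProduct (subsets N) (subsets (N + N))

  pairs-unique : List.Unique pairs
  pairs-unique = Unique.cartesianProduct⁺ (subsets-unique N) (subsets-unique (N + N))

  ∈-pairs : ∀ p → p List.∈ pairs
  ∈-pairs (R , H) = ∈-cartesianProduct⁺ (∈-subsets R) (∈-subsets H)

  opaque
    unfolding count

    sum-ℱ : ∀ f r → ListAction.sum (List.map (λ R → ℱ W (f R)) (rimSets N r)) ≡ count (rootedForest? f r) pairs
    sum-ℱ f r = sym (trans (count-cartesianProduct (rootedForest? f r) (subsets N) (subsets (N + N)))
      (sum-filter (λ R → ∣ R ∣ ℕ.≟ r) _ _
        (λ {R} eq → count-cong (λ H → rootedForest? f r (R , H)) (isRootedSpanningForest? W (f R)) proj₂ (eq ,_) (subsets (N + N)))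
        (λ {R} ≢r → count-none (λ H → rootedForest? f r (R , H)) (λ _ → ≢r ∘ proj₁) (subsets (N + N)))
        (subsets N)))

  A-pairs : ∀ r → A N 3≤N r ≡ count (rootedForest? rim r) pairs
  A-pairs = sum-ℱ rim

  B-pairs : ∀ r → B N 3≤N r ≡ count (rootedForest? c∪rim r) pairs
  B-pairs = sum-ℱ c∪rim

-- The correspondence between words and forests

module Counting (k : ℕ) (3≤N : 3 ≤ 3 + k) where
  open Wheel k 3≤N
  open Completeness k 3≤N

  Forest : Subset (suc N) → SpanningSubgraph W → Set
  Forest = IsRootedSpanningForest W

  module _ {w w′ : Word N} (good : Good w) (same-roots : roots w ≡ roots w′) (same-edges : edges w ≡ edges w′) where

    private
      same-ρ : ∀ {i} → lookup w i ≡ ρ → lookup w′ i ≡ ρ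
      same-ρ {i} p = ∈-comprehension⁻ (λ i → lookup w′ i ≟ᴸ ρ)
        (subst (i ∈_) same-roots (∈-comprehension⁺ (λ i → lookup w i ≟ᴸ ρ) p))

      same-uses : ∀ x → Uses w x → Uses w′ x
      same-uses x u = has⁻ {w′} x (subst (λ H → Has H x) same-edges (has⁺ {w} x u))

    -- The edge that `w` uses by ▸ at `i` must be used in `w′` by ◂ at the next vertex. There `w`
    -- has no ρ or κ, since `w′` would share it, and no ◂, by goodness; so it has ▸ again and the
    -- clash moves on.
    opposite-arrows : ∀ {i} → lookup w i ≡ ▸ → lookup w′ i ≡ ◂ →
                      ∀ d → lookup w (next^ d i) ≡ ▸ × lookup w′ (next^ d i) ≡ ◂
    opposite-arrows p q zero    = p , q
    opposite-arrows {i} p q (suc d) with opposite-arrows p q d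
    ... | p′ , q′ with same-uses (inj₁ (next^ d i)) (inj₁ p′)
    ...   | inj₁ r = case trans (sym q′) r of λ ()
    ...   | inj₂ r with lookup w (next (next^ d i)) in s
    ...     | ρ = case trans (sym (same-ρ s)) r of λ ()
    ...     | κ = case trans (sym (same-uses (inj₂ (next^ (suc d) i)) s)) r of λ ()
    ...     | ◂ = contradiction s (good (next^ d i) p′)
    ...     | ▸ = refl , r

    same-token : ∀ {i} → Token (lookup w i) → lookup w′ i ≡ lookup w i
    same-token {i} t with lookup w i in p
    ... | ρ = same-ρ p
    ... | κ = same-uses (inj₂ i) p

  word-unique : ∀ {w w′} → Good w → Good w′ → roots w ≡ roots w′ → edges w ≡ edges w′ →
                ∀ {t} → Token (lookup w t) → w ≡ w′
  word-unique {w} {w′} good good′ rs es {t} token = trans (sym (tabulate∘lookup w))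
    (trans (tabulate-cong same) (tabulate∘lookup w′))
    where
    token′ : Token (lookup w′ t)
    token′ = subst Token (sym (same-token good rs es token)) token

    no-clash : ∀ {i} → lookup w i ≡ ▸ → lookup w′ i ≡ ◂ → ⊥
    no-clash {i} p q = let d , eq = next^-reach i t in
      case subst Token (trans (cong (lookup w) (sym eq)) (proj₁ (opposite-arrows good rs es p q d))) token of λ ()

    no-clash′ : ∀ {i} → lookup w i ≡ ◂ → lookup w′ i ≡ ▸ → ⊥
    no-clash′ {i} p q = let d , eq = next^-reach i t in
      case subst Token (trans (cong (lookup w′) (sym eq))
        (proj₁ (opposite-arrows good′ (sym rs) (sym es) q p d))) token′ of λ ()

    same : ∀ i → lookup w i ≡ lookup w′ i
    same i with token? (lookup w i) | token? (lookup w′ i)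
    ... | yes tk | _      = sym (same-token good rs es tk)
    ... | no _   | yes tk = same-token good′ (sym rs) (sym es) tk
    ... | no ¬t  | no ¬t′ with lookup w i in p | lookup w′ i in q
    ...   | ρ | _ = contradiction ρ ¬t
    ...   | κ | _ = contradiction κ ¬t
    ...   | _ | ρ = contradiction ρ ¬t′
    ...   | _ | κ = contradiction κ ¬t′
    ...   | ◂ | ◂ = refl
    ...   | ▸ | ▸ = refl
    ...   | ▸ | ◂ = contradiction q (no-clash p)
    ...   | ◂ | ▸ = contradiction q (no-clash′ p)

  toHub⇒ascends : ∀ {w i} → ToHub w i → ∃ (Ascends w (suc i) zero)
  toHub⇒ascends (hub p)      = _ , up (κ↑ p) (here here)
  toHub⇒ascends (right p h)  = _ , up (▸↑ p) (proj₂ (toHub⇒ascends h))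
  toHub⇒ascends (left e p h) = _ , up (◂↑ e p) (proj₂ (toHub⇒ascends h))

  ascends⇒toHub : ∀ {w i d} → Ascends w (suc i) zero d → ToHub w i
  ascends⇒toHub (up (κ↑ p) _)   = hub p
  ascends⇒toHub (up (▸↑ p) a)   = right p (ascends⇒toHub a)
  ascends⇒toHub (up (◂↑ e p) a) = left e p (ascends⇒toHub a)

  toHub⇒connected : ∀ {w i} → ToHub w i → Connected W (edges w) (suc i) zero
  toHub⇒connected {w} h = ascends⇒connected w (parent-functional w) (parent-orphan w) (parent⇒adjacent w)
    (adjacent⇒parent w) (proj₂ (toHub⇒ascends h))

  connected⇒toHub : ∀ {w i} → Connected W (edges w) (suc i) zero → ToHub w i
  connected⇒toHub {w} c = ascends⇒toHub (proj₂ (connected⇒ascends w (parent-functional w) (parent-orphan w)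
    (parent⇒adjacent w) (adjacent⇒parent w) (Connected-sym W c) (_ , here here)))

  -- A chain of parents carries no bound on its length, but its existence amounts to connectedness
  -- with the centre, which is decidable.
  toHub? : ∀ w → Decidable (ToHub w)
  toHub? w i = map′ connected⇒toHub toHub⇒connected (connected? W (edges w) (suc i) zero)

  Rooted : ℕ → Word N → Set
  Rooted r w = Good w × ∣ roots w ∣ ≡ r

  rooted? : ∀ r → Decidable (Rooted r)
  rooted? r w = good? w ×-dec (∣ roots w ∣ ℕ.≟ r)

  HubRooted : ℕ → Fin N → Word N → Set
  HubRooted r i w = Rooted r w × ToHub w i

  hubRooted? : ∀ r i → Decidable (HubRooted r i)
  hubRooted? r i w = rooted? r w ×-dec toHub? w i

  open RimForests N 3≤N

  ρ-exists : ∀ {n} (w : Word n) {r} → ∣ roots w ∣ ≡ suc r → ∃ λ t → Token (lookup w t)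
  ρ-exists (ρ ∷ w) _  = zero , ρ
  -- Any token will do, so the search may stop before it meets the ρ.
  ρ-exists (κ ∷ w) _  = zero , κ
  ρ-exists (◂ ∷ w) eq = let t , p = ρ-exists w eq in suc t , p
  ρ-exists (▸ ∷ w) eq = let t , p = ρ-exists w eq in suc t , p

  -- Having at least one root provides the token on which both `word⇒forest` and `word-unique` rely.
  B-words : ∀ r → B N 3≤N (suc r) ≡ count (rooted? (suc r)) (words N)
  B-words r = trans (B-pairs (suc r))
    (sym (count-bijection (rooted? (suc r)) (rootedForest? c∪rim (suc r))
      (words-unique N) pairs-unique ∈-words ∈-pairs (λ w → roots w , edges w) into inj onto))
    where
    into : ∀ {w} → Rooted (suc r) w → RootedForest c∪rim (suc r) (roots w , edges w)
    into {w} (good , eq) = eq , word⇒forest w good (proj₂ (ρ-exists w eq))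

    inj : ∀ {v w} → Rooted (suc r) v → Rooted (suc r) w → (roots v , edges v) ≡ (roots w , edges w) → v ≡ w
    inj {v} (good , e) (good′ , _) eq =
      word-unique good good′ (cong proj₁ eq) (cong proj₂ eq) (proj₂ (ρ-exists v e))

    onto : ∀ {p} → RootedForest c∪rim (suc r) p → ∃ λ w → Rooted (suc r) w × (roots w , edges w) ≡ p
    onto (eq , F) = word F , (word-good F , trans (cong ∣_∣ (roots-word F)) eq) , cong₂ _,_ (roots-word F) (edges-word F)

  count-hubWords : ∀ r i → count (hubRooted? r i) (words N) ≡ count (hubRooted? r zero) (words N)
  count-hubWords r i = let d , eq = next^-reach zero i in
    trans (cong (λ i → count (hubRooted? r i) (words N)) (sym eq)) (from-zero d)
    where
    step : ∀ i → count (hubRooted? r (next i)) (words N) ≡ count (hubRooted? r i) (words N)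
    step i = count-bijection (hubRooted? r (next i)) (hubRooted? r i)
      (words-unique N) (words-unique N) ∈-words ∈-words rotate
      (λ { {w} ((good , eq) , h) → (good-rotate⁺ w good , trans (∣roots-rotate∣ w) eq) , toHub-rotate⁺ refl h })
      (λ _ _ → rotate-injective)
      λ { {w} ((good , eq) , h) → case rotate-surjective w of λ { (v , refl) →
        v , ((good-rotate⁻ v good , trans (sym (∣roots-rotate∣ v)) eq) , toHub-rotate⁻ h) , refl } }

    from-zero : ∀ d → count (hubRooted? r (next^ d zero)) (words N) ≡ count (hubRooted? r zero) (words N)
    from-zero zero    = refl
    from-zero (suc d) = trans (step (next^ d zero)) (from-zero d)

  private
    Marked : ℕ → Fin N × Word N → Set
    Marked r (i , w) = HubRooted r i w

    marked? : ∀ r → Decidable (Marked r)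
    marked? r (i , w) = hubRooted? r i w

    -- The vertex `i` takes over from the centre as root of their common component. It was not a
    -- root before, since its parents lead to κ, so the number of rim roots goes up by one.
    mark : Fin N × Word N → Subset N × SpanningSubgraph W
    mark (i , w) = roots w [ i ]≔ inside , edges w

    unmarked : ∀ {i} (w : Word N) → ToHub w i → lookup (roots w) i ≡ outside
    unmarked {i} w h with lookup (roots w) i in eq
    ... | outside = refl
    ... | inside  = contradiction (∈-comprehension⁻ (λ i → lookup w i ≟ᴸ ρ) (lookup⇒[]= i _ eq)) (toHub-≢ρ h)

    ∈-update⁻ : ∀ {n} {S : Subset n} {i j} → j ∈ S [ i ]≔ inside → j ≡ i ⊎ j ∈ S
    ∈-update⁻ {S = S} {i} {j} j∈ with j Fin.≟ i
    ... | yes eq = inj₁ eq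
    ... | no ≢i  = inj₂ (lookup⇒[]= j S (trans (sym (lookup∘update′ ≢i S inside)) ([]=⇒lookup j∈)))

    marked⇒forest : ∀ {r i w} → HubRooted r i w → Forest (rim (roots w [ i ]≔ inside)) (edges w)
    marked⇒forest {i = i} {w} ((good , _) , h) = reroot here
      (Connected-sym W (toHub⇒connected h)) (there ([]≔-updates (roots w) i))
      (λ { here ≢0 → contradiction refl ≢0
         ; {suc j} (there j∈) _ → there (case j Fin.≟ i of λ
             { (yes refl) → []≔-updates (roots w) i ; (no ≢i) → []≔-minimal (roots w) j i ≢i j∈ }) })
      (λ { (there j∈) → case ∈-update⁻ j∈ of λ { (inj₁ refl) → inj₁ refl ; (inj₂ j∈) → inj₂ (there j∈ , λ ()) } })
      -- The token is the κ at the end of the chain: for `r` equal to 0 the word has no ρ.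
      (word⇒forest w good (subst Token (sym (proj₂ (toHub-κ h))) κ))

    marked-into : ∀ {r p} → Marked r p → RootedForest rim (suc r) (mark p)
    marked-into {p = i , w} p@((_ , eq) , h) =
      trans (∣[]≔inside∣ (roots w) i (unmarked w h)) (cong suc eq) , marked⇒forest p

    restore : ∀ (S : Subset N) {i} → lookup S i ≡ outside → (S [ i ]≔ inside) [ i ]≔ outside ≡ S
    restore S {i} eq = trans ([]≔-idempotent S i) (trans (cong (S [ i ]≔_) (sym eq)) ([]≔-lookup S i))

    -- Both marked vertices are the root of the component of the centre in one forest, so they
    -- coincide. Erasing the mark then recovers the roots of the word.
    marked-injective : ∀ {r p q} → Marked r p → Marked r q → mark p ≡ mark q → p ≡ q
    marked-injective {p = i , v} {j , w} p@((good , _) , h) ((good′ , _) , h′) eq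
      with refl ← Fin.suc-injective (roots-disconnected (marked⇒forest p) (there ([]≔-updates (roots v) i))
             (subst (suc j ∈_) (cong rim (sym (cong proj₁ eq))) (there ([]≔-updates (roots w) j)))
             (toHub⇒connected h ◅◅ Connected-sym W
               (subst (λ H → Connected W H (suc j) zero) (sym (cong proj₂ eq)) (toHub⇒connected h′))))
      = cong (i ,_) (word-unique good good′
          (trans (sym (restore (roots v) (unmarked v h)))
            (trans (cong (_[ i ]≔ outside) (cong proj₁ eq)) (restore (roots w) (unmarked w h′))))
          (cong proj₂ eq) (subst Token (sym (proj₂ (toHub-κ h))) κ))

    marked-onto : ∀ {r p} → RootedForest rim (suc r) p → ∃ λ q → Marked r q × mark q ≡ p
    marked-onto {r} {R , H} (eq , F) with IsRootedSpanningForest.uniqueRoot F zero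
    ... | suc i , (there i∈ , c) , _ = (i , w) , ((word-good F′ , card) , toHub) ,
            cong₂ _,_ (trans (cong (_[ i ]≔ inside) (roots-word F′)) reinserted) (edges-word F′)
      where
      R′ : Subset N
      R′ = R [ i ]≔ outside

      reinserted : R′ [ i ]≔ inside ≡ R
      reinserted = trans ([]≔-idempotent R i) (trans (cong (R [ i ]≔_) (sym ([]=⇒lookup i∈))) ([]≔-lookup R i))

      F′ : Forest (c∪rim R′) H
      F′ = reroot (there i∈) (Connected-sym W c) here
        (λ { {zero} ()
           ; {suc j} (there j∈) ≢i → there ([]≔-minimal R j i (≢i ∘ cong suc) j∈) })
        (λ { here → inj₁ refl
           ; {suc j} (there j∈) → inj₂ (case j Fin.≟ i of λ
              { (yes refl) → case trans (sym ([]=⇒lookup j∈)) (lookup∘update i R outside) of λ ()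
              ; (no ≢i) → there (lookup⇒[]= j R (trans (sym (lookup∘update′ ≢i R outside)) ([]=⇒lookup j∈)))
                          , ≢i ∘ Fin.suc-injective }) })
        F

      w : Word N
      w = word F′

      card : ∣ roots w ∣ ≡ r
      card = ℕ.suc-injective (trans (cong (suc ∘ ∣_∣) (roots-word F′)) (trans
        (sym (∣[]≔inside∣ R′ i (lookup∘update i R outside))) (trans (cong ∣_∣ reinserted) eq)))

      toHub : ToHub w i
      toHub = connected⇒toHub (subst (λ H → Connected W H (suc i) zero) (sym (edges-word F′)) (Connected-sym W c))

  A-words : ∀ r → A N 3≤N (suc r) ≡ N * count (hubRooted? r zero) (words N)
  A-words r = begin
    A N 3≤N (suc r)
      ≡⟨ A-pairs (suc r) ⟩
    count (rootedForest? rim (suc r)) pairs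
      ≡⟨ count-bijection (marked? r) (rootedForest? rim (suc r))
           (Unique.cartesianProduct⁺ (Unique.allFin⁺ N) (words-unique N)) pairs-unique
           (λ (i , w) → ∈-cartesianProduct⁺ (∈-allFin i) (∈-words w)) ∈-pairs
           mark marked-into marked-injective marked-onto ⟨
    count (marked? r) (cartesianProduct (allFin N) (words N))
      ≡⟨ count-cartesianProduct (marked? r) (allFin N) (words N) ⟩
    ListAction.sum (List.map (λ i → count (hubRooted? r i) (words N)) (allFin N))
      ≡⟨ sum-const _ _ (allFin N) (count-hubWords r) ⟩
    length (allFin N) * count (hubRooted? r zero) (words N)
      ≡⟨ cong (_* count (hubRooted? r zero) (words N)) (List.length-tabulate {n = N} (λ i → i)) ⟩
    N * count (hubRooted? r zero) (words N)
      ∎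
    where open ≡-Reasoning

-- Words read linearly

Ok : Letter → Letter → Set
Ok ▸ ◂ = ⊥
Ok _ _ = ⊤

ok? : ∀ a b → Dec (Ok a b)
ok? ρ b = yes tt
ok? κ b = yes tt
ok? ◂ b = yes tt
ok? ▸ ρ = yes tt
ok? ▸ κ = yes tt
ok? ▸ ◂ = no λ ()
ok? ▸ ▸ = yes tt

ok⁺ : ∀ {a b} → (a ≡ ▸ → b ≢ ◂) → Ok a b
ok⁺ {ρ}     f = tt
ok⁺ {κ}     f = tt
ok⁺ {◂}     f = tt
ok⁺ {▸} {ρ} f = tt
ok⁺ {▸} {κ} f = tt
ok⁺ {▸} {◂} f = contradiction refl (f refl)
ok⁺ {▸} {▸} f = tt

ok⁻ : ∀ {a b} → Ok a b → a ≡ ▸ → b ≢ ◂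
ok⁻ () refl refl

-- The outer letters are the neighbours of the word. A cyclic word `a ∷ w` is good when `w` may
-- stand between two copies of `a`. On the left only ▸ restricts `w`, on the right only ◂, so all
-- other neighbours are interchangeable.
Chain : ∀ {n} → Letter → Word n → Letter → Set
Chain p []      q = Ok p q
Chain p (a ∷ w) q = Ok p a × Chain a w q

chain? : ∀ {n} p (w : Word n) q → Dec (Chain p w q)
chain? p []      q = ok? p q
chain? p (a ∷ w) q = ok? p a ×-dec chain? a w q

chain⁺ : ∀ {n a} (w : Word n) {q} → (∀ i → Ok (lookup (a ∷ w) i) (lookup (w ∷ʳ q) i)) → Chain a w q
chain⁺ []      ok = ok zero
chain⁺ (b ∷ w) ok = ok zero , chain⁺ w (ok ∘ suc)

chain⁻ : ∀ {n a} (w : Word n) {q} → Chain a w q → ∀ i → Ok (lookup (a ∷ w) i) (lookup (w ∷ʳ q) i)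
chain⁻ []      c       zero    = c
chain⁻ (b ∷ w) (o , c) zero    = o
chain⁻ (b ∷ w) (o , c) (suc i) = chain⁻ w c i

good⇒chain : ∀ {n a} (w : Word n) → Good (a ∷ w) → Chain a w a
good⇒chain {a = a} w good = chain⁺ w λ i →
  ok⁺ λ p q → good i p (trans (sym (lookup-rotate (a ∷ w) i)) q)

chain⇒good : ∀ {n a} (w : Word n) → Chain a w a → Good (a ∷ w)
chain⇒good {a = a} w c i p q = ok⁻ (chain⁻ w c i) p (trans (lookup-rotate (a ∷ w) i) q)

-- The word has a prefix ▸ ⋯ ▸ κ, possibly with no arrow.
Leads : ∀ {n} → Word n → Set
Leads []      = ⊥
Leads (ρ ∷ w) = ⊥
Leads (κ ∷ w) = ⊤
Leads (◂ ∷ w) = ⊥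
Leads (▸ ∷ w) = Leads w

leads? : ∀ {n} (w : Word n) → Dec (Leads w)
leads? []      = no λ ()
leads? (ρ ∷ w) = no λ ()
leads? (κ ∷ w) = yes tt
leads? (◂ ∷ w) = no λ ()
leads? (▸ ∷ w) = leads? w

-- The word s w ends with κ ◂ ⋯ ◂, where s tells whether this is so for what precedes w.
data State : Set where
  on off : State

Ends : ∀ {n} → State → Word n → Set
Ends s   (ρ ∷ w) = Ends off w
Ends s   (κ ∷ w) = Ends on w
Ends s   (◂ ∷ w) = Ends s w
Ends s   (▸ ∷ w) = Ends off w
Ends on  []      = ⊤
Ends off []      = ⊥

ends? : ∀ {n} s (w : Word n) → Dec (Ends s w)
ends? on  []      = yes tt
ends? off []      = no λ ()
ends? s   (ρ ∷ w) = ends? off w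
ends? s   (κ ∷ w) = ends? on w
ends? s   (◂ ∷ w) = ends? s w
ends? s   (▸ ∷ w) = ends? off w

leads⁺ : ∀ {n} (w : Word n) j → (∀ i → toℕ i < toℕ j → lookup w i ≡ ▸) → lookup w j ≡ κ → Leads w
leads⁺ (a ∷ w) zero    _ refl = tt
leads⁺ (a ∷ w) (suc j) ▸s eq with ▸s zero (s≤s z≤n)
... | refl = leads⁺ w j (λ i i<j → ▸s (suc i) (s≤s i<j)) eq

leads⁻ : ∀ {n} (w : Word n) → Leads w → ∃ λ j → (∀ i → toℕ i < toℕ j → lookup w i ≡ ▸) × lookup w j ≡ κ
leads⁻ (κ ∷ w) l = zero , (λ _ ()) , refl
leads⁻ (▸ ∷ w) l with leads⁻ w l
... | j , ▸s , eq = suc j , (λ { zero _ → refl ; (suc i) (s≤s i<j) → ▸s i i<j }) , eq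

ends-◂s : ∀ {n} (w : Word n) → (∀ i → lookup w i ≡ ◂) → Ends on w
ends-◂s []      _  = tt
ends-◂s (a ∷ w) ◂s with ◂s zero
... | refl = ends-◂s w (◂s ∘ suc)

ends⁺ : ∀ {n} s (w : Word n) j → (∀ i → toℕ j < toℕ i → lookup w i ≡ ◂) → lookup w j ≡ κ → Ends s w
ends⁺ s (κ ∷ w) zero    ◂s refl = ends-◂s w λ i → ◂s (suc i) (s≤s z≤n)
ends⁺ s (ρ ∷ w) (suc j) ◂s eq = ends⁺ off w j (λ i j<i → ◂s (suc i) (s≤s j<i)) eq
ends⁺ s (κ ∷ w) (suc j) ◂s eq = ends⁺ on w j (λ i j<i → ◂s (suc i) (s≤s j<i)) eq
ends⁺ s (◂ ∷ w) (suc j) ◂s eq = ends⁺ s w j (λ i j<i → ◂s (suc i) (s≤s j<i)) eq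
ends⁺ s (▸ ∷ w) (suc j) ◂s eq = ends⁺ off w j (λ i j<i → ◂s (suc i) (s≤s j<i)) eq

EndsAt : ∀ {n} → Word n → Fin n → Set
EndsAt w j = (∀ i → toℕ j < toℕ i → lookup w i ≡ ◂) × lookup w j ≡ κ

private
  endsAt-∷ : ∀ {n a} {w : Word n} → ∃ (EndsAt w) → ∃ (EndsAt (a ∷ w))
  endsAt-∷ (j , ◂s , eq) = suc j , (λ { (suc i) (s≤s j<i) → ◂s i j<i }) , eq

  endsAt-κ : ∀ {n} {w : Word n} → (∀ i → lookup w i ≡ ◂) → ∃ (EndsAt (κ ∷ w))
  endsAt-κ ◂s = zero , (λ { (suc i) _ → ◂s i }) , refl

-- In the case `all`, the final κ is not in `w`: it is the one remembered by the state `on`.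
data EndsView {n} (w : Word n) : State → Set where
  at  : ∀ {s} → ∃ (EndsAt w) → EndsView w s
  all : (∀ i → lookup w i ≡ ◂) → EndsView w on

ends⁻ : ∀ {n} s (w : Word n) → Ends s w → EndsView w s
ends⁻ on []      e = all λ ()
ends⁻ s  (ρ ∷ w) e with ends⁻ off w e
... | at j = at (endsAt-∷ j)
ends⁻ s  (κ ∷ w) e with ends⁻ on w e
... | at j   = at (endsAt-∷ j)
... | all ◂s = at (endsAt-κ ◂s)
ends⁻ s  (◂ ∷ w) e with ends⁻ s w e
... | at j   = at (endsAt-∷ j)
... | all ◂s = all λ { zero → refl ; (suc i) → ◂s i }
ends⁻ s  (▸ ∷ w) e with ends⁻ off w e
... | at j = at (endsAt-∷ j)

-- Reaching κ from the first letter, as a condition on the linear word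

module _ {n} (u : Word (suc n)) where

  module _ (good : Good u) where

    toHub⇒▸s : ∀ {i} → ToHub u i → lookup u i ≢ ◂ →
               ∃ λ d → (∀ {a} → a < d → lookup u (next^ a i) ≡ ▸) × lookup u (next^ d i) ≡ κ
    toHub⇒▸s (hub p)      ≢◂ = 0 , (λ ()) , p
    toHub⇒▸s (left _ p _) ≢◂ = contradiction p ≢◂
    toHub⇒▸s {i} (right p h) ≢◂ with toHub⇒▸s h (good i p)
    ... | d , ▸s , q = suc d
        , (λ { {zero} _ → p ; {suc a} (s≤s a<d) → trans (cong (lookup u) (sym (next^-next a i))) (▸s a<d) })
        , trans (cong (lookup u) (sym (next^-next d i))) q

    toHub⇒◂s : ∀ {i} → ToHub u i → lookup u i ≢ ▸ →
               ∃ λ t → ∃ λ d → next^ d t ≡ i × (∀ {a} → a < d → lookup u (next^ (suc a) t) ≡ ◂) × lookup u t ≡ κ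
    toHub⇒◂s {i} (hub p)  ≢▸ = i , 0 , refl , (λ ()) , p
    toHub⇒◂s (right p _)  ≢▸ = contradiction p ≢▸
    toHub⇒◂s (left {i} refl p h) ≢▸ with toHub⇒◂s h (λ q → good i q p)
    ... | t , d , refl , ◂s , q = t , suc d , refl , (λ a<1+d → case ℕ.m≤n⇒m<n∨m≡n (ℕ.≤-pred a<1+d) of λ
            { (inj₁ a<d) → ◂s a<d ; (inj₂ refl) → p }) , q

    toHub⇒leads : ToHub u zero → lookup u zero ≢ ◂ → Leads u
    toHub⇒leads h ≢◂ with toHub⇒▸s h ≢◂
    ... | d , ▸s , eq = leads⁺ u (next^ d zero) before eq
      where
      -- No upper bound on `d` is at hand; it is enough that the position of `next^ d zero` is a
      -- remainder of `d`, hence at most `d`.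
      before : ∀ i → toℕ i < toℕ (next^ d (zero {n})) → lookup u i ≡ ▸
      before i i<j = trans (cong (lookup u) (Fin.toℕ-injective (sym (next^-zero (ℕ.≤-pred (Fin.toℕ<n i))))))
        (▸s (ℕ.<-≤-trans i<j (ℕ.≤-trans (ℕ.≤-reflexive (toℕ-next^ d zero))
          (ℕ.≤-trans (m%n≤m (d + 0) (suc n)) (ℕ.≤-reflexive (ℕ.+-identityʳ d))))))

    toHub⇒ends : ToHub u zero → lookup u zero ≡ ◂ → Ends off u
    toHub⇒ends h ≡◂ with toHub⇒◂s h (λ q → case trans (sym q) ≡◂ of λ ())
    ... | t , d , eq , ◂s , q = ends⁺ off u t after q
      where
      after : ∀ i → toℕ t < toℕ i → lookup u i ≡ ◂
      after i t<i with toℕ i ∸ toℕ t ℕ.≤? d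
      ... | yes le = trans (cong (lookup u) (sym reach)) (◂s {toℕ i ∸ suc (toℕ t)} (ℕ.≤-trans (ℕ.≤-reflexive (sym e≡)) le))
        where
        e≡ : toℕ i ∸ toℕ t ≡ suc (toℕ i ∸ suc (toℕ t))
        e≡ = ℕ.+-∸-assoc 1 t<i
        reach : next^ (suc (toℕ i ∸ suc (toℕ t))) t ≡ i
        reach = Fin.toℕ-injective (trans (toℕ-next^ (suc (toℕ i ∸ suc (toℕ t))) t)
          (trans (cong (λ x → (x + toℕ t) % suc n) (sym e≡))
            (trans (cong (_% suc n) (ℕ.m∸n+n≡m (ℕ.<⇒≤ t<i))) (m<n⇒m%n≡m (Fin.toℕ<n i)))))
      -- Here `d` steps from `t` end before `i` without wrapping round, and yet at `zero`. So `t` is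
      -- `zero`, whose letter is ◂ and not κ.
      ... | no ≰ = contradiction (trans (sym ≡◂) (trans (cong (lookup u) (sym t≡0)) q)) λ ()
        where
        d+t<N : d + toℕ t < suc n
        d+t<N = ℕ.<-trans (ℕ.<-≤-trans (ℕ.+-monoˡ-< (toℕ t) (ℕ.≰⇒> ≰)) (ℕ.≤-reflexive (ℕ.m∸n+n≡m (ℕ.<⇒≤ t<i)))) (Fin.toℕ<n i)
        d+t≡0 : d + toℕ t ≡ 0
        d+t≡0 = trans (sym (m<n⇒m%n≡m d+t<N)) (trans (sym (toℕ-next^ d t)) (cong toℕ eq))
        t≡0 : t ≡ zero
        t≡0 = Fin.toℕ-injective (ℕ.m+n≡0⇒n≡0 d d+t≡0)

  ▸s⇒toHub : ∀ d {i} → (∀ {a} → a < d → lookup u (next^ a i) ≡ ▸) → lookup u (next^ d i) ≡ κ → ToHub u i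
  ▸s⇒toHub zero    ▸s eq = hub eq
  ▸s⇒toHub (suc d) {i} ▸s eq = right (▸s (s≤s z≤n))
    (▸s⇒toHub d (λ {a} a<d → trans (cong (lookup u) (next^-next a i)) (▸s (s≤s a<d)))
      (trans (cong (lookup u) (next^-next d i)) eq))

  ◂s⇒toHub : ∀ d {t} → (∀ {a} → a < d → lookup u (next^ (suc a) t) ≡ ◂) → lookup u t ≡ κ → ToHub u (next^ d t)
  ◂s⇒toHub zero    ◂s eq = hub eq
  ◂s⇒toHub (suc d) ◂s eq = left refl (◂s ℕ.≤-refl) (◂s⇒toHub d (λ a<d → ◂s (ℕ.m<n⇒m<1+n a<d)) eq)

  leads⇒toHub : Leads u → ToHub u zero
  leads⇒toHub l with leads⁻ u l
  ... | j , ▸s , eq = ▸s⇒toHub (toℕ j)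
      (λ {a} a<j → ▸s (next^ a zero) (subst (_< toℕ j) (sym (next^-zero (ℕ.≤-trans (ℕ.<⇒≤ a<j) j≤n))) a<j))
      (trans (cong (lookup u) (Fin.toℕ-injective (next^-zero j≤n))) eq)
    where
    j≤n : toℕ j ≤ n
    j≤n = ℕ.≤-pred (Fin.toℕ<n j)

  ends⇒toHub : lookup u zero ≡ ◂ → Ends off u → ToHub u zero
  ends⇒toHub ≡◂ e with ends⁻ off u e
  -- From `t`, this many steps just wrap round to `zero`. All letters passed are ◂ by `◂s`, except
  -- that the last one, at `zero`, is so by hypothesis.
  ... | at (t , ◂s , eq) = subst (ToHub u) back (◂s⇒toHub (suc n ∸ toℕ t) letters-◂ eq)
    where
    t≤N : toℕ t ≤ suc n
    t≤N = ℕ.<⇒≤ (Fin.toℕ<n t)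
    back : next^ (suc n ∸ toℕ t) t ≡ zero
    back = Fin.toℕ-injective (trans (toℕ-next^ (suc n ∸ toℕ t) t)
      (trans (cong (_% suc n) (ℕ.m∸n+n≡m t≤N)) (n%n≡0 (suc n))))
      where open import Data.Nat.DivMod using (n%n≡0)
    letters-◂ : ∀ {a} → a < suc n ∸ toℕ t → lookup u (next^ (suc a) t) ≡ ◂
    letters-◂ {a} a< with next^ (suc a) t in i≡
    ... | zero  = ≡◂
    ... | suc i = ◂s (suc i) (subst (toℕ t <_) (sym position) (s≤s (ℕ.m≤n+m (toℕ t) a)))
      where
      a+t<N : suc a + toℕ t ≤ suc n
      a+t<N = ℕ.≤-trans (ℕ.+-monoˡ-≤ (toℕ t) a<) (ℕ.≤-reflexive (ℕ.m∸n+n≡m t≤N))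
      position : toℕ (suc i) ≡ suc a + toℕ t
      position with ℕ.m≤n⇒m<n∨m≡n a+t<N
      ... | inj₁ lt = trans (cong toℕ (sym i≡)) (trans (toℕ-next^ (suc a) t) (m<n⇒m%n≡m lt))
      ... | inj₂ eq = contradiction (trans (cong toℕ (sym i≡)) (trans (toℕ-next^ (suc a) t)
              (trans (cong (_% suc n) eq) (n%n≡0 (suc n))))) λ ()

chain-≢▸ : ∀ {n p p′} (w : Word n) {q} → p′ ≢ ▸ → Chain p w q → Chain p′ w q
chain-≢▸ []      p′≢ c       = ok⁺ λ eq → contradiction eq p′≢
chain-≢▸ (a ∷ w) p′≢ (_ , c) = ok⁺ (λ eq → contradiction eq p′≢) , c

chain-≢◂ : ∀ {n p} (w : Word n) {q q′} → q′ ≢ ◂ → Chain p w q → Chain p w q′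
chain-≢◂ []      q′≢ c       = ok⁺ λ _ → q′≢
chain-≢◂ (a ∷ w) q′≢ (o , c) = o , chain-≢◂ w q′≢ c

-- Counting linear words by their first letter

guard : ∀ {P : Set} → Dec P → ℕ → ℕ
guard P? n = if does P? then n else 0

guard-intro : ∀ {P : Set} (P? : Dec P) {m n} → (P → m ≡ n) → (¬ P → m ≡ 0) → m ≡ guard P? n
guard-intro (yes p) eq ≡0 = eq p
guard-intro (no ¬p) eq ≡0 = ≡0 ¬p

opaque
  unfolding count

  count-[_] : ∀ {A : Set} {P : A → Set} (P? : Decidable P) x → count P? (x ∷ []) ≡ guard (P? x) 1
  count-[ P? ] x with P? x
  ... | yes _ = refl
  ... | no  _ = refl

  count-words-suc : ∀ {n} {P : Word (suc n) → Set} (P? : Decidable P) → count P? (words (suc n)) ≡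
    count (P? ∘ (ρ ∷_)) (words n) + (count (P? ∘ (κ ∷_)) (words n) +
    (count (P? ∘ (◂ ∷_)) (words n) + count (P? ∘ (▸ ∷_)) (words n)))
  count-words-suc {n} P? =
    trans (count-++ P? (List.map (ρ ∷_) (words n)) _) (cong₂ _+_ (count-map P? (ρ ∷_) (words n))
    (trans (count-++ P? (List.map (κ ∷_) (words n)) _) (cong₂ _+_ (count-map P? (κ ∷_) (words n))
    (trans (count-++ P? (List.map (◂ ∷_) (words n)) _) (cong₂ _+_ (count-map P? (◂ ∷_) (words n))
    (trans (cong (count P?) (List.++-identityʳ (List.map (▸ ∷_) (words n)))) (count-map P? (▸ ∷_) (words n))))))))

shift : (ℕ → ℕ) → ℕ → ℕ
shift f zero    = 0
shift f (suc r) = f r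

shift-cong : ∀ {f g} → f ≗ g → shift f ≗ shift g
shift-cong eq zero    = refl
shift-cong eq (suc r) = eq r

shift-+ : ∀ f g r → shift (λ r → f r + g r) r ≡ shift f r + shift g r
shift-+ f g zero    = refl
shift-+ f g (suc r) = refl

-- On generating functions in the number of roots, ρ is multiplication by y.
prefix : Letter → (ℕ → ℕ) → ℕ → ℕ
prefix ρ f = shift f
prefix _ f = f

module _ {n} (p q : Letter) {T : Word n → Set} (T? : Decidable T) (r : ℕ) where

  Linear : Word n → Set
  Linear w = Chain p w q × ∣ roots w ∣ ≡ r × T w

  linear? : Decidable Linear
  linear? w = chain? p w q ×-dec ((∣ roots w ∣ ℕ.≟ r) ×-dec T? w)

  linear : ℕ
  linear = count linear? (words n)

all? : ∀ {n} → Decidable {A = Word n} (λ _ → ⊤)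
all? _ = yes tt

module _ {n} {T : Word n → Set} (T? : Decidable T) where

  linear-≢▸ : ∀ {p} p′ {q r} → p ≢ ▸ → p′ ≢ ▸ → linear p q T? r ≡ linear p′ q T? r
  linear-≢▸ {p} p′ {q} {r} p≢ p′≢ = count-cong (linear? p q T? r) (linear? p′ q T? r)
    (λ { {w} (c , t) → chain-≢▸ w p′≢ c , t }) (λ { {w} (c , t) → chain-≢▸ w p≢ c , t }) (words n)

  linear-≢◂ : ∀ {p q} q′ {r} → q ≢ ◂ → q′ ≢ ◂ → linear p q T? r ≡ linear p q′ T? r
  linear-≢◂ {p} {q} q′ {r} q≢ q′≢ = count-cong (linear? p q T? r) (linear? p q′ T? r)
    (λ { {w} (c , t) → chain-≢◂ w q′≢ c , t }) (λ { {w} (c , t) → chain-≢◂ w q≢ c , t }) (words n)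

  linear-none : ∀ {p q r} → (∀ w → ¬ T w) → linear p q T? r ≡ 0
  linear-none {p} {q} {r} ¬t = count-none (linear? p q T? r) (λ w (_ , _ , t) → ¬t w t) (words n)

  linear-few : ∀ {p q r} → n < r → linear p q T? r ≡ 0
  linear-few {p} {q} {r} n<r = count-none (linear? p q T? r)
    (λ w (_ , eq , _) → ℕ.<⇒≱ n<r (ℕ.≤-trans (ℕ.≤-reflexive (sym eq)) (∣p∣≤n (roots w)))) (words n)

  -- Stripping the first letter `a`. The predicate `P` is abstract so that the same step applies to
  -- linear words, to cyclic words and to those whose first vertex leads to κ.
  count-prefix : ∀ a q {P : ℕ → Word n → Set} (P? : ∀ r → Decidable (P r)) →
    (∀ {r w} → P r w → Chain a w q × ∣ roots (a ∷ w) ∣ ≡ r × T w) →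
    (∀ {r w} → Chain a w q → ∣ roots (a ∷ w) ∣ ≡ r → T w → P r w) →
    ∀ r → count (P? r) (words n) ≡ prefix a (linear a q T?) r
  count-prefix ρ q P? to from zero    = count-none (P? 0) (λ w p → case proj₁ (proj₂ (to p)) of λ ()) (words n)
  count-prefix ρ q P? to from (suc r) = count-cong (P? (suc r)) (linear? ρ q T? r)
    (λ p → let c , eq , t = to p in c , ℕ.suc-injective eq , t) (λ (c , eq , t) → from c (cong suc eq) t) (words n)
  count-prefix κ q P? to from r = count-cong (P? r) (linear? κ q T? r) to (λ (c , eq , t) → from c eq t) (words n)
  count-prefix ◂ q P? to from r = count-cong (P? r) (linear? ◂ q T? r) to (λ (c , eq , t) → from c eq t) (words n)
  count-prefix ▸ q P? to from r = count-cong (P? r) (linear? ▸ q T? r) to (λ (c , eq , t) → from c eq t) (words n)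

linear-0 : ∀ p q {T : Word 0 → Set} (T? : Decidable T) r →
           linear p q T? r ≡ guard (ok? p q) (guard (0 ℕ.≟ r) (guard (T? []) 1))
linear-0 p q T? r = trans (count-[ linear? p q T? r ] []) (guards r)
  where
  guards : ∀ r → guard (linear? p q T? r []) 1 ≡ guard (ok? p q) (guard (0 ℕ.≟ r) (guard (T? []) 1))
  guards r with ok? p q
  guards r       | no  _ = refl
  guards zero    | yes _ = refl
  guards (suc r) | yes _ = refl

linear-suc : ∀ {n} p q {T : Word (suc n) → Set} (T? : Decidable T) r →
  let term = λ a → guard (ok? p a) (prefix a (linear a q (T? ∘ (a ∷_))) r) in
  linear p q T? r ≡ term ρ + (term κ + (term ◂ + term ▸))
linear-suc {n} p q T? r = trans (count-words-suc (linear? p q T? r))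
  (cong₂ _+_ (term ρ) (cong₂ _+_ (term κ) (cong₂ _+_ (term ◂) (term ▸))))
  where
  term : ∀ a → count (linear? p q T? r ∘ (a ∷_)) (words n) ≡
               guard (ok? p a) (prefix a (linear a q (T? ∘ (a ∷_))) r)
  term a = guard-intro (ok? p a)
    (λ o → count-prefix (T? ∘ (a ∷_)) a q (λ r → linear? p q T? r ∘ (a ∷_))
      (λ ((_ , c) , e , t) → c , e , t) (λ c e t → (o , c) , e , t) r)
    (λ ¬o → count-none (linear? p q T? r ∘ (a ∷_)) (λ w ((o , _) , _) → ¬o o) (words n))

-- F counts all the linear words with r roots, and E those that may follow ▸.
F E : ℕ → ℕ → ℕ
F n r = linear {n} κ κ all? r
E n r = linear {n} ▸ κ all? r

private
  -- These variants with ◂ on the right arise from cyclic words that begin with ◂.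
  F◂ E◂ : ℕ → ℕ → ℕ
  F◂ n r = linear {n} κ ◂ all? r
  E◂ n r = linear {n} ▸ ◂ all? r

F-suc : ∀ n r → F (suc n) r ≡ shift (F n) r + (F n r + (F n r + E n r))
F-suc n r = trans (linear-suc κ κ all? r) (cong₂ (λ x y → x + (F n r + (y + E n r)))
  (shift-cong (λ r → linear-≢▸ all? κ (λ ()) (λ ())) r) (linear-≢▸ all? κ (λ ()) (λ ())))

E-suc : ∀ n r → E (suc n) r ≡ shift (F n) r + (F n r + E n r)
E-suc n r = trans (linear-suc ▸ κ all? r) (cong (λ x → x + (F n r + E n r))
  (shift-cong (λ r → linear-≢▸ all? κ (λ ()) (λ ())) r))

-- The words that may not follow ▸ are those beginning with ◂, and what comes after this ◂ is
-- arbitrary.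
F≡E+F : ∀ n r → F (suc n) r ≡ E (suc n) r + F n r
F≡E+F n r = trans (F-suc n r) (trans (lemma (shift (F n) r) (F n r) (E n r)) (cong (_+ F n r) (sym (E-suc n r))))
  where
  lemma : ∀ x f e → x + (f + (f + e)) ≡ x + (f + e) + f
  lemma = ℕ-Solver.solve-∀

F-0 : ∀ r → F 0 r ≡ guard (0 ℕ.≟ r) 1
F-0 = linear-0 κ κ all?

E-0 : ∀ r → E 0 r ≡ guard (0 ℕ.≟ r) 1
E-0 = linear-0 ▸ κ all?

F-1 : ∀ r → F 1 r ≡ 3 * F 0 r + shift (F 0) r
F-1 r = trans (F-suc 0 r) (trans (cong (λ e → shift (F 0) r + (F 0 r + (F 0 r + e))) (trans (E-0 r) (sym (F-0 r))))
  (lemma (shift (F 0) r) (F 0 r)))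
  where
  lemma : ∀ x f → x + (f + (f + f)) ≡ 3 * f + x
  lemma = ℕ-Solver.solve-∀

-- The recurrence with characteristic polynomial 1 - (3 + y) z + z², obtained by eliminating `E`
-- with `F≡E+F`. The negative term is moved to the left so as to stay in ℕ.
F-2+ : ∀ n r → F (2 + n) r + F n r ≡ 3 * F (suc n) r + shift (F (suc n)) r
F-2+ n r = trans (cong (_+ F n r) (F-suc (suc n) r)) (trans
  (lemma₁ (shift (F (suc n)) r) (F (suc n) r) (E (suc n) r) (F n r))
  (trans (cong (λ t → shift (F (suc n)) r + (F (suc n) r + (F (suc n) r + t))) (sym (F≡E+F n r)))
    (lemma₂ (shift (F (suc n)) r) (F (suc n) r))))
  where
  lemma₁ : ∀ x f e g → x + (f + (f + e)) + g ≡ x + (f + (f + (e + g)))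
  lemma₁ = ℕ-Solver.solve-∀
  lemma₂ : ∀ x f → x + (f + (f + f)) ≡ 3 * f + x
  lemma₂ = ℕ-Solver.solve-∀

private
  F◂≡F-0 : ∀ r → F◂ 0 r ≡ F 0 r
  F◂≡F-0 r = trans (linear-0 κ ◂ all? r) (sym (F-0 r))

  F◂-suc : ∀ n r → F◂ (suc n) r ≡ shift (F◂ n) r + (F◂ n r + (F◂ n r + E◂ n r))
  F◂-suc n r = trans (linear-suc κ ◂ all? r) (cong₂ (λ x y → x + (F◂ n r + (y + E◂ n r)))
    (shift-cong (λ r → linear-≢▸ all? κ (λ ()) (λ ())) r) (linear-≢▸ all? κ (λ ()) (λ ())))

  E◂-suc : ∀ n r → E◂ (suc n) r ≡ shift (F◂ n) r + (F◂ n r + E◂ n r)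
  E◂-suc n r = trans (linear-suc ▸ ◂ all? r) (cong (λ x → x + (F◂ n r + E◂ n r))
    (shift-cong (λ r → linear-≢▸ all? κ (λ ()) (λ ())) r))

mutual
  -- The mirror image of a word exchanges ▸ before it and ◂ after it.
  F◂≡E : ∀ n r → F◂ n r ≡ E n r
  F◂≡E zero    r = trans (linear-0 κ ◂ all? r) (sym (E-0 r))
  F◂≡E (suc zero) r = trans (F◂-suc 0 r) (trans (cong₂ _+_ (shift-cong F◂≡F-0 r)
    (cong₂ _+_ (F◂≡F-0 r) (cong₂ _+_ (F◂≡E 0 r) (linear-0 ▸ ◂ all? r))))
    (trans (cong (λ t → shift (F 0) r + (F 0 r + t)) (ℕ.+-identityʳ (E 0 r))) (sym (E-suc 0 r))))
  F◂≡E (suc (suc n)) r = begin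
    F◂ (2 + n) r
      ≡⟨ F◂-suc (suc n) r ⟩
    shift (F◂ (suc n)) r + (F◂ (suc n) r + (F◂ (suc n) r + E◂ (suc n) r))
      ≡⟨ cong₂ _+_ (shift-cong (F◂≡E (suc n)) r) (cong₂ (λ x y → x + (x + y)) (F◂≡E (suc n) r) (E◂≡ n r)) ⟩
    shift (E (suc n)) r + (E (suc n) r + (E (suc n) r + (shift (F n) r + F n r)))
      ≡⟨ lemma (shift (E (suc n)) r) (E (suc n) r) (shift (F n) r) (F n r) ⟩
    (shift (E (suc n)) r + shift (F n) r) + ((E (suc n) r + F n r) + E (suc n) r)
      ≡⟨ cong₂ (λ x y → x + (y + E (suc n) r))
           (trans (shift-cong (F≡E+F n) r) (shift-+ (E (suc n)) (F n) r)) (F≡E+F n r) ⟨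
    shift (F (suc n)) r + (F (suc n) r + E (suc n) r)
      ≡⟨ E-suc (suc n) r ⟨
    E (2 + n) r
      ∎
    where
    open ≡-Reasoning
    lemma : ∀ x e y f → x + (e + (e + (y + f))) ≡ (x + y) + ((e + f) + e)
    lemma = ℕ-Solver.solve-∀

  -- A word between ▸ and ◂ consists of ▸ ⋯ ▸, a token, and a word that ◂ may follow. The token
  -- contributes 1 + y; the counts of the rest, `E 0` to `E n` by symmetry, add up to `F n` by
  -- `F≡E+F`.
  E◂≡ : ∀ n r → E◂ (suc n) r ≡ shift (F n) r + F n r
  E◂≡ zero r = trans (E◂-suc 0 r) (trans (cong₂ _+_ (shift-cong F◂≡F-0 r) (cong₂ _+_ (F◂≡F-0 r) (linear-0 ▸ ◂ all? r)))
    (cong (λ x → shift (F 0) r + x) (ℕ.+-identityʳ (F 0 r))))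
  E◂≡ (suc n) r = begin
    E◂ (2 + n) r
      ≡⟨ E◂-suc (suc n) r ⟩
    shift (F◂ (suc n)) r + (F◂ (suc n) r + E◂ (suc n) r)
      ≡⟨ cong₂ _+_ (shift-cong (F◂≡E (suc n)) r) (cong₂ _+_ (F◂≡E (suc n) r) (E◂≡ n r)) ⟩
    shift (E (suc n)) r + (E (suc n) r + (shift (F n) r + F n r))
      ≡⟨ lemma (shift (E (suc n)) r) (E (suc n) r) (shift (F n) r) (F n r) ⟩
    (shift (E (suc n)) r + shift (F n) r) + (E (suc n) r + F n r)
      ≡⟨ cong₂ _+_ (trans (shift-cong (F≡E+F n) r) (shift-+ (E (suc n)) (F n) r)) (F≡E+F n r) ⟨
    shift (F (suc n)) r + F (suc n) r
      ∎
    where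
    open ≡-Reasoning
    lemma : ∀ x e y f → x + (e + (y + f)) ≡ (x + y) + (e + f)
    lemma = ℕ-Solver.solve-∀

-- Linear words with an initial ▸ ⋯ ▸ κ or a final κ ◂ ⋯ ◂

partialSum : (ℕ → ℕ → ℕ) → ℕ → ℕ → ℕ
partialSum f zero    r = 0
partialSum f (suc n) r = f n r + partialSum f n r

private
  zero-guard : ∀ {P : Set} (d : Dec P) → guard d 0 ≡ 0
  zero-guard (yes _) = refl
  zero-guard (no  _) = refl

  shift-0 : ∀ r → shift (λ _ → 0) r ≡ 0
  shift-0 zero    = refl
  shift-0 (suc r) = refl

-- After the prefix ▸ ⋯ ▸ κ any word may follow; the sum runs over its length.
leads-sum : ∀ n r → linear {n} ▸ ▸ leads? r ≡ partialSum F n r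
leads-sum zero    r = trans (linear-0 ▸ ▸ leads? r) (zero-guard (0 ℕ.≟ r))
leads-sum (suc n) r = trans (linear-suc ▸ ▸ leads? r) (cong₂ _+_
  (trans (shift-cong (λ r → linear-none (leads? ∘ (ρ ∷_)) λ _ ()) r) (shift-0 r))
  (cong₂ _+_ (linear-≢◂ all? κ (λ ()) (λ ())) (leads-sum n r)))

private
  δ : ℕ → ℕ
  δ r = guard (0 ℕ.≟ r) 1

  shift-partialSum : ∀ f n r → shift (partialSum f (suc n)) r ≡ shift (f n) r + shift (partialSum f n) r
  shift-partialSum f n = shift-+ (f n) (partialSum f n)

  -- `E-suc` summed over the lengths; `δ` is the contribution of the empty word.
  partialSum-E : ∀ n r → partialSum E (suc n) r ≡
    shift (partialSum F n) r + (partialSum F n r + (δ r + partialSum E n r))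
  partialSum-E zero    zero    = cong (_+ 0) (E-0 0)
  partialSum-E zero    (suc r) = cong (_+ 0) (E-0 (suc r))
  partialSum-E (suc n) r = begin
    E (suc n) r + partialSum E (suc n) r
      ≡⟨ cong₂ _+_ (E-suc n r) (partialSum-E n r) ⟩
    shift (F n) r + (F n r + E n r) + (shift (partialSum F n) r + (partialSum F n r + (δ r + partialSum E n r)))
      ≡⟨ lemma (shift (F n) r) (F n r) (E n r) (shift (partialSum F n) r) (partialSum F n r) (δ r) (partialSum E n r) ⟩
    (shift (F n) r + shift (partialSum F n) r) + ((F n r + partialSum F n r) + (δ r + (E n r + partialSum E n r)))
      ≡⟨ cong (_+ ((F n r + partialSum F n r) + (δ r + (E n r + partialSum E n r)))) (shift-partialSum F n r) ⟨
    shift (partialSum F (suc n)) r + (partialSum F (suc n) r + (δ r + partialSum E (suc n) r))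
      ∎
    where
    open ≡-Reasoning
    lemma : ∀ x f e y g d h → x + (f + e) + (y + (g + (d + h))) ≡ (x + y) + ((f + g) + (d + (e + h)))
    lemma = ℕ-Solver.solve-∀

  partialSum-F≡E+F : ∀ n r → partialSum F (suc n) r ≡ partialSum E (suc n) r + partialSum F n r
  partialSum-F≡E+F zero    r = cong (_+ 0) (trans (F-0 r) (trans (sym (E-0 r)) (sym (ℕ.+-identityʳ (E 0 r)))))
  partialSum-F≡E+F (suc n) r = trans (cong₂ _+_ (F≡E+F n r) (partialSum-F≡E+F n r))
    (lemma (E (suc n) r) (F n r) (partialSum E (suc n) r) (partialSum F n r))
    where
    lemma : ∀ e f g h → (e + f) + (g + h) ≡ (e + g) + (f + h)
    lemma = ℕ-Solver.solve-∀

-- A suffix cannot be stripped from the front, hence a simultaneous induction over the states.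
-- Removing κ ◂ ⋯ ◂ from the end leaves any word, or after ▸ one counted by `E`. The state `on`
-- admits one word more, ◂ ⋯ ◂, which has no roots: this is `δ`. After ▸ the state is always `off`,
-- so three counts suffice.
ends-sum : ∀ n r → linear {n} κ ◂ (ends? off) r ≡ partialSum F n r ×
                   linear {n} κ ◂ (ends? on) r ≡ partialSum F n r + δ r ×
                   linear {n} ▸ ◂ (ends? off) r ≡ partialSum E n r
ends-sum zero r = trans (linear-0 κ ◂ (ends? off) r) (zero-guard (0 ℕ.≟ r))
              , linear-0 κ ◂ (ends? on) r
              , linear-0 ▸ ◂ (ends? off) r
ends-sum (suc n) r with ends-sum n r
... | y , x , z = trans (linear-suc κ ◂ (ends? off) r) (trans (cong₂ _+_ roots-first (cong₂ _+_ x (cong₂ _+_ ◂-first z)))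
                    (trans (lemma₁ ys ps (δ r) es) (sym sum-F)))
                , trans (linear-suc κ ◂ (ends? on) r) (trans (cong₂ _+_ roots-first (cong₂ _+_ x
                    (cong₂ _+_ (trans (linear-≢▸ (ends? on) κ (λ ()) (λ ())) x) z)))
                    (trans (lemma₂ ys ps (δ r) es) (cong (_+ δ r) (sym sum-F))))
                , trans (linear-suc ▸ ◂ (ends? off) r) (trans (cong₂ _+_ roots-first (cong₂ _+_ x z))
                    (trans (lemma₃ ys ps (δ r) es) (sym (partialSum-E n r))))
  where
  ys = shift (partialSum F n) r
  ps = partialSum F n r
  es = partialSum E n r
  sum-F : partialSum F (suc n) r ≡ ys + (ps + (δ r + es)) + ps
  sum-F = trans (partialSum-F≡E+F n r) (cong (_+ ps) (partialSum-E n r))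
  roots-first : shift (λ r → linear {n} ρ ◂ (ends? off) r) r ≡ ys
  roots-first = shift-cong (λ r → trans (linear-≢▸ (ends? off) κ (λ ()) (λ ())) (proj₁ (ends-sum n r))) r
  ◂-first : linear {n} ◂ ◂ (ends? off) r ≡ ps
  ◂-first = trans (linear-≢▸ (ends? off) κ (λ ()) (λ ())) y
  lemma₁ : ∀ y p d e → y + ((p + d) + (p + e)) ≡ y + (p + (d + e)) + p
  lemma₁ = ℕ-Solver.solve-∀
  lemma₂ : ∀ y p d e → y + ((p + d) + ((p + d) + e)) ≡ y + (p + (d + e)) + p + d
  lemma₂ = ℕ-Solver.solve-∀
  lemma₃ : ∀ y p d e → y + ((p + d) + e) ≡ y + (p + (d + e))
  lemma₃ = ℕ-Solver.solve-∀

-- Counting cyclic words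

module CountWords (k : ℕ) (3≤N : 3 ≤ 3 + k) where
  open Wheel k 3≤N using (N)
  open Counting k 3≤N

  private
    n : ℕ
    n = 2 + k

    closed : ∀ a r → count (rooted? r ∘ (a ∷_)) (words n) ≡ prefix a (linear {n} a a all?) r
    closed a = count-prefix all? a a (λ r → rooted? r ∘ (a ∷_))
      (λ { {w = w} (good , eq) → good⇒chain w good , eq , tt }) (λ { {w = w} c eq _ → chain⇒good w c , eq })

  -- The rest of the word stands between two copies of the first letter. For ρ and κ it is free; for
  -- ▸ and ◂ it is restricted on one side only, and by symmetry both give `E`.
  count-rooted : ∀ r → count (rooted? r) (words N) ≡ shift (F n) r + (F n r + (E n r + E n r))
  count-rooted r = trans (count-words-suc (rooted? r)) (cong₂ _+_
    (trans (closed ρ r) (shift-cong (λ r → trans (linear-≢▸ all? κ (λ ()) (λ ())) (linear-≢◂ all? κ (λ ()) (λ ()))) r))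
    (cong₂ _+_ (closed κ r) (cong₂ _+_
      (trans (closed ◂ r) (trans (linear-≢▸ all? κ (λ ()) (λ ())) (F◂≡E n r)))
      (trans (closed ▸ r) (linear-≢◂ all? κ (λ ()) (λ ()))))))

  -- If κ comes first, the rest is free; ◂ and ▸ give equal partial sums, one of which absorbs the
  -- term for κ. In the variable z, the two partial sums account for the factor (1 + z) / (1 - z).
  count-hubRooted : ∀ r → count (hubRooted? r zero) (words N) ≡ partialSum F (suc n) r + partialSum F n r
  count-hubRooted r = trans (count-words-suc (hubRooted? r zero)) (trans (cong₂ _+_ none (cong₂ _+_ at-κ (cong₂ _+_ at-◂ at-▸)))
    (sym (ℕ.+-assoc (F n r) _ _)))
    where
    none : count (hubRooted? r zero ∘ (ρ ∷_)) (words n) ≡ 0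
    none = count-none (hubRooted? r zero ∘ (ρ ∷_)) (λ w (_ , h) → toHub-≢ρ h refl) (words n)
    at-κ : count (hubRooted? r zero ∘ (κ ∷_)) (words n) ≡ F n r
    at-κ = count-prefix all? κ κ (λ r → hubRooted? r zero ∘ (κ ∷_))
      (λ { {w = w} ((good , eq) , _) → good⇒chain w good , eq , tt })
      (λ { {w = w} c eq _ → (chain⇒good w c , eq) , hub refl }) r
    at-◂ : count (hubRooted? r zero ∘ (◂ ∷_)) (words n) ≡ partialSum F n r
    at-◂ = trans (count-prefix (ends? off) ◂ ◂ (λ r → hubRooted? r zero ∘ (◂ ∷_))
      (λ { {w = w} ((good , eq) , h) → good⇒chain w good , eq , toHub⇒ends (◂ ∷ w) good h refl })
      (λ { {w = w} c eq e → (chain⇒good w c , eq) , ends⇒toHub (◂ ∷ w) refl e }) r)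
      (trans (linear-≢▸ (ends? off) κ (λ ()) (λ ())) (proj₁ (ends-sum n r)))
    at-▸ : count (hubRooted? r zero ∘ (▸ ∷_)) (words n) ≡ partialSum F n r
    at-▸ = trans (count-prefix leads? ▸ ▸ (λ r → hubRooted? r zero ∘ (▸ ∷_))
      (λ { {w = w} ((good , eq) , h) → good⇒chain w good , eq , toHub⇒leads (▸ ∷ w) good h λ () })
      (λ { {w = w} c eq l → (chain⇒good w c , eq) , leads⇒toHub (▸ ∷ w) l }) r) (leads-sum n r)

-- Power series

tail : Series → Series
tail f = f ∘ suc

⊛-congˡ : ∀ f {g g′} → g ≗ g′ → f ⊛ g ≗ f ⊛ g′
⊛-congˡ f g≗ zero    = cong (λ x → f 0 ℤ.* x ℤ.+ 0ℤ) (g≗ 0)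
⊛-congˡ f g≗ (suc n) = cong₂ ℤ._+_ (cong (f 0 ℤ.*_) (g≗ (suc n))) (⊛-congˡ (tail f) g≗ n)

⊛-congʳ : ∀ {f f′} g → f ≗ f′ → f ⊛ g ≗ f′ ⊛ g
⊛-congʳ g f≗ zero    = cong (λ x → x ℤ.* g 0 ℤ.+ 0ℤ) (f≗ 0)
⊛-congʳ g f≗ (suc n) = cong₂ ℤ._+_ (cong (ℤ._* g (suc n)) (f≗ 0)) (⊛-congʳ g (f≗ ∘ suc) n)

-- The product unfolds by itself at the first coefficient of `f`; commutativity needs the unfolding
-- at the other end.
⊛-lastʳ : ∀ f g n → (f ⊛ g) (suc n) ≡ (f ⊛ tail g) n ℤ.+ f (suc n) ℤ.* g 0
⊛-lastʳ f g zero    = lemma (f 0 ℤ.* g 1) (f 1 ℤ.* g 0)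
  where
  lemma : ∀ x y → x ℤ.+ (y ℤ.+ 0ℤ) ≡ x ℤ.+ 0ℤ ℤ.+ y
  lemma = ℤ-Solver.solve-∀
⊛-lastʳ f g (suc n) = trans (cong (λ t → f 0 ℤ.* g (2 + n) ℤ.+ t) (⊛-lastʳ (tail f) g n))
  (sym (ℤ.+-assoc (f 0 ℤ.* g (2 + n)) ((tail f ⊛ tail g) n) (f (2 + n) ℤ.* g 0)))

⊛-comm : ∀ f g → f ⊛ g ≗ g ⊛ f
⊛-comm f g zero    = cong (ℤ._+ 0ℤ) (ℤ.*-comm (f 0) (g 0))
⊛-comm f g (suc n) = begin
  f 0 ℤ.* g (suc n) ℤ.+ (tail f ⊛ g) n    ≡⟨ cong₂ ℤ._+_ (ℤ.*-comm (f 0) (g (suc n))) (⊛-comm (tail f) g n) ⟩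
  g (suc n) ℤ.* f 0 ℤ.+ (g ⊛ tail f) n    ≡⟨ ℤ.+-comm _ ((g ⊛ tail f) n) ⟩
  (g ⊛ tail f) n ℤ.+ g (suc n) ℤ.* f 0    ≡⟨ ⊛-lastʳ g f n ⟨
  (g ⊛ f) (suc n)                         ∎
  where open ≡-Reasoning

-- The combination with `a` is the shape of `tail (f ⊛ g)`, as needed for associativity.
⊛-distribʳ : ∀ f g h a n → ((λ k → a ℤ.* f k ℤ.+ g k) ⊛ h) n ≡ a ℤ.* (f ⊛ h) n ℤ.+ (g ⊛ h) n
⊛-distribʳ f g h a zero    = lemma a (f 0) (g 0) (h 0)
  where
  lemma : ∀ a x y z → (a ℤ.* x ℤ.+ y) ℤ.* z ℤ.+ 0ℤ ≡ a ℤ.* (x ℤ.* z ℤ.+ 0ℤ) ℤ.+ (y ℤ.* z ℤ.+ 0ℤ)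
  lemma = ℤ-Solver.solve-∀
⊛-distribʳ f g h a (suc n) = trans
  (cong (λ t → (a ℤ.* f 0 ℤ.+ g 0) ℤ.* h (suc n) ℤ.+ t) (⊛-distribʳ (tail f) (tail g) h a n))
  (lemma a (f 0) (g 0) (h (suc n)) ((tail f ⊛ h) n) ((tail g ⊛ h) n))
  where
  lemma : ∀ a x y z s t → (a ℤ.* x ℤ.+ y) ℤ.* z ℤ.+ (a ℤ.* s ℤ.+ t) ≡ a ℤ.* (x ℤ.* z ℤ.+ s) ℤ.+ (y ℤ.* z ℤ.+ t)
  lemma = ℤ-Solver.solve-∀

⊛-assoc : ∀ f g h → (f ⊛ g) ⊛ h ≗ f ⊛ (g ⊛ h)
⊛-assoc f g h zero    = lemma (f 0) (g 0) (h 0)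
  where
  lemma : ∀ x y z → (x ℤ.* y ℤ.+ 0ℤ) ℤ.* z ℤ.+ 0ℤ ≡ x ℤ.* (y ℤ.* z ℤ.+ 0ℤ) ℤ.+ 0ℤ
  lemma = ℤ-Solver.solve-∀
⊛-assoc f g h (suc n) = begin
  (f 0 ℤ.* g 0 ℤ.+ 0ℤ) ℤ.* h (suc n) ℤ.+ ((λ k → f 0 ℤ.* tail g k ℤ.+ (tail f ⊛ g) k) ⊛ h) n
    ≡⟨ cong (λ t → (f 0 ℤ.* g 0 ℤ.+ 0ℤ) ℤ.* h (suc n) ℤ.+ t) (⊛-distribʳ (tail g) (tail f ⊛ g) h (f 0) n) ⟩
  (f 0 ℤ.* g 0 ℤ.+ 0ℤ) ℤ.* h (suc n) ℤ.+ (f 0 ℤ.* (tail g ⊛ h) n ℤ.+ ((tail f ⊛ g) ⊛ h) n)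
    ≡⟨ cong (λ t → (f 0 ℤ.* g 0 ℤ.+ 0ℤ) ℤ.* h (suc n) ℤ.+ (f 0 ℤ.* (tail g ⊛ h) n ℤ.+ t)) (⊛-assoc (tail f) g h n) ⟩
  (f 0 ℤ.* g 0 ℤ.+ 0ℤ) ℤ.* h (suc n) ℤ.+ (f 0 ℤ.* (tail g ⊛ h) n ℤ.+ (tail f ⊛ (g ⊛ h)) n)
    ≡⟨ lemma (f 0) (g 0) (h (suc n)) ((tail g ⊛ h) n) ((tail f ⊛ (g ⊛ h)) n) ⟩
  f 0 ℤ.* (g 0 ℤ.* h (suc n) ℤ.+ (tail g ⊛ h) n) ℤ.+ (tail f ⊛ (g ⊛ h)) n
    ∎
  where
  open ≡-Reasoning
  lemma : ∀ x y z s t → (x ℤ.* y ℤ.+ 0ℤ) ℤ.* z ℤ.+ (x ℤ.* s ℤ.+ t) ≡ x ℤ.* (y ℤ.* z ℤ.+ s) ℤ.+ t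
  lemma = ℤ-Solver.solve-∀

⊛-zeroˡ : ∀ f → (λ _ → 0ℤ) ⊛ f ≗ λ _ → 0ℤ
⊛-zeroˡ f zero    = refl
⊛-zeroˡ f (suc n) = trans (ℤ.+-identityˡ _) (⊛-zeroˡ f n)

⊛-identityˡ : ∀ f → one ⊛ f ≗ f
⊛-identityˡ f zero    = trans (ℤ.+-identityʳ _) (ℤ.*-identityˡ (f 0))
⊛-identityˡ f (suc n) = trans (cong₂ ℤ._+_ (ℤ.*-identityˡ (f (suc n))) (⊛-zeroˡ f n)) (ℤ.+-identityʳ _)

⁻¹-inverseˡ : ∀ f → f 0 ≡ 1ℤ → f ⁻¹ ⊛ f ≗ one
⁻¹-inverseˡ f f₀ n = trans (⊛-comm (f ⁻¹) f n) (⁻¹-inverseʳ f f₀ n)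

⁻¹-unique : ∀ f {g} → f 0 ≡ 1ℤ → f ⊛ g ≗ one → g ≗ f ⁻¹
⁻¹-unique f {g} f₀ fg n = begin
  g n                   ≡⟨ ⊛-identityˡ g n ⟨
  (one ⊛ g) n           ≡⟨ ⊛-congʳ g (⁻¹-inverseˡ f f₀) n ⟨
  ((f ⁻¹ ⊛ f) ⊛ g) n    ≡⟨ ⊛-assoc (f ⁻¹) f g n ⟩
  (f ⁻¹ ⊛ (f ⊛ g)) n    ≡⟨ ⊛-congˡ (f ⁻¹) fg n ⟩
  (f ⁻¹ ⊛ one) n        ≡⟨ ⊛-comm (f ⁻¹) one n ⟩
  (one ⊛ f ⁻¹) n        ≡⟨ ⊛-identityˡ (f ⁻¹) n ⟩
  (f ⁻¹) n              ∎
  where open ≡-Reasoning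

⁻¹-cancelˡ : ∀ f g → g 0 ≡ 1ℤ → (f ⊛ g) 0 ≡ 1ℤ → f ⊛ (f ⊛ g) ⁻¹ ≗ g ⁻¹
⁻¹-cancelˡ f g g₀ fg₀ = ⁻¹-unique g g₀ λ n → begin
  (g ⊛ (f ⊛ h)) n    ≡⟨ ⊛-assoc g f h n ⟨
  ((g ⊛ f) ⊛ h) n    ≡⟨ ⊛-congʳ h (⊛-comm g f) n ⟩
  ((f ⊛ g) ⊛ h) n    ≡⟨ ⁻¹-inverseʳ (f ⊛ g) fg₀ n ⟩
  one n              ∎
  where
  open ≡-Reasoning
  h = (f ⊛ g) ⁻¹

linear-⊛ : ∀ a b f n → (poly (a ∷ b ∷ []) ⊛ f) (suc n) ≡ a ℤ.* f (suc n) ℤ.+ b ℤ.* f n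
linear-⊛ a b f zero    = cong (λ t → a ℤ.* f 1 ℤ.+ t) (ℤ.+-identityʳ _)
linear-⊛ a b f (suc n) = cong (λ t → a ℤ.* f (2 + n) ℤ.+ t)
  (trans (cong (λ t → b ℤ.* f (suc n) ℤ.+ t) (⊛-zeroˡ f n)) (ℤ.+-identityʳ _))

quadratic-⊛ : ∀ a b c f n → (poly (a ∷ b ∷ c ∷ []) ⊛ f) (2 + n) ≡
              a ℤ.* f (2 + n) ℤ.+ (b ℤ.* f (suc n) ℤ.+ c ℤ.* f n)
quadratic-⊛ a b c f n = cong (λ t → a ℤ.* f (2 + n) ℤ.+ t) (linear-⊛ b c f n)

-- The powers of 1 / (1 - 3z + z²)

D⁻ : ℕ → Series
D⁻ r = (1-3z+z² ^ r) ⁻¹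

D⁻-suc : ∀ r → 1-3z+z² ⊛ D⁻ (suc r) ≗ D⁻ r
D⁻-suc r = ⁻¹-cancelˡ 1-3z+z² (1-3z+z² ^ r) (1-3z+z²^r-constant r) (1-3z+z²^r-constant (suc r))

D⁻-zero : D⁻ 0 ≗ one
D⁻-zero n = sym (⁻¹-unique one {one} refl (⊛-identityˡ one) n)

D⁻-suc-0 : ∀ r → D⁻ (suc r) 0 ≡ D⁻ r 0
D⁻-suc-0 r = trans (sym (trans (ℤ.+-identityʳ _) (ℤ.*-identityˡ _))) (D⁻-suc r 0)

D⁻-suc-1 : ∀ r → D⁻ (suc r) 1 ≡ + 3 ℤ.* D⁻ (suc r) 0 ℤ.+ D⁻ r 1
D⁻-suc-1 r = trans (lemma (D⁻ (suc r) 1) (D⁻ (suc r) 0)) (cong (λ t → + 3 ℤ.* D⁻ (suc r) 0 ℤ.+ t) (D⁻-suc r 1))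
  where
  lemma : ∀ x y → x ≡ + 3 ℤ.* y ℤ.+ (+ 1 ℤ.* x ℤ.+ (ℤ.- + 3 ℤ.* y ℤ.+ 0ℤ))
  lemma = ℤ-Solver.solve-∀

-- Arranged in the form of `F-2+`, with which it will be compared.
D⁻-suc-2+ : ∀ r n → D⁻ (suc r) (2 + n) ℤ.+ D⁻ (suc r) n ≡ + 3 ℤ.* D⁻ (suc r) (suc n) ℤ.+ D⁻ r (2 + n)
D⁻-suc-2+ r n = trans (lemma (D⁻ (suc r) (2 + n)) (D⁻ (suc r) (suc n)) (D⁻ (suc r) n))
  (cong (λ t → + 3 ℤ.* D⁻ (suc r) (suc n) ℤ.+ t)
    (trans (sym (quadratic-⊛ (+ 1) (ℤ.- + 3) (+ 1) (D⁻ (suc r)) n)) (D⁻-suc r (2 + n))))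
  where
  lemma : ∀ x y z → x ℤ.+ z ≡ + 3 ℤ.* y ℤ.+ (+ 1 ℤ.* x ℤ.+ (ℤ.- + 3 ℤ.* y ℤ.+ + 1 ℤ.* z))
  lemma = ℤ-Solver.solve-∀

⊛-scaleʳ : ∀ f g a n → (f ⊛ λ k → a ℤ.* g k) n ≡ a ℤ.* (f ⊛ g) n
⊛-scaleʳ f g a zero    = lemma (f 0) a (g 0)
  where
  lemma : ∀ x a y → x ℤ.* (a ℤ.* y) ℤ.+ 0ℤ ≡ a ℤ.* (x ℤ.* y ℤ.+ 0ℤ)
  lemma = ℤ-Solver.solve-∀
⊛-scaleʳ f g a (suc n) = trans (cong (λ t → f 0 ℤ.* (a ℤ.* g (suc n)) ℤ.+ t) (⊛-scaleʳ (tail f) g a n))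
  (lemma (f 0) a (g (suc n)) ((tail f ⊛ g) n))
  where
  lemma : ∀ x a y t → x ℤ.* (a ℤ.* y) ℤ.+ a ℤ.* t ≡ a ℤ.* (x ℤ.* y ℤ.+ t)
  lemma = ℤ-Solver.solve-∀

⊛-cancelˡ : ∀ f {g h} → f 0 ≡ 1ℤ → f ⊛ g ≗ f ⊛ h → g ≗ h
⊛-cancelˡ f {g} {h} f₀ eq n = begin
  g n                   ≡⟨ undo g ⟨
  (f ⁻¹ ⊛ (f ⊛ g)) n    ≡⟨ ⊛-congˡ (f ⁻¹) eq n ⟩
  (f ⁻¹ ⊛ (f ⊛ h)) n    ≡⟨ undo h ⟩
  h n                   ∎
  where
  open ≡-Reasoning
  undo : ∀ g → (f ⁻¹ ⊛ (f ⊛ g)) n ≡ g n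
  undo g = trans (sym (⊛-assoc (f ⁻¹) f g n)) (trans (⊛-congʳ g (⁻¹-inverseˡ f f₀) n) (⊛-identityˡ g n))

-- The operator z d/dz.
θ : Series → Series
θ f n = + n ℤ.* f n

-- -θ (1 - 3z + z²)
3z-2z² : Series
3z-2z² = poly (+ 0 ∷ + 3 ∷ ℤ.- + 2 ∷ [])

-- The product rule solved for the term with `θ f`. One factor is a fixed quadratic polynomial, so
-- it is an identity between at most three coefficients of `f`.
θ-leibniz : ∀ f n → (1-3z+z² ⊛ θ f) n ≡ θ (1-3z+z² ⊛ f) n ℤ.+ (3z-2z² ⊛ f) n
θ-leibniz f zero = lemma (f 0)
  where
  lemma : ∀ x → + 1 ℤ.* (+ 0 ℤ.* x) ℤ.+ 0ℤ ≡ + 0 ℤ.* (+ 1 ℤ.* x ℤ.+ 0ℤ) ℤ.+ (+ 0 ℤ.* x ℤ.+ 0ℤ)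
  lemma = ℤ-Solver.solve-∀
θ-leibniz f (suc zero) = lemma (f 1) (f 0)
  where
  lemma : ∀ x y → + 1 ℤ.* (+ 1 ℤ.* x) ℤ.+ (ℤ.- + 3 ℤ.* (+ 0 ℤ.* y) ℤ.+ 0ℤ) ≡
                  + 1 ℤ.* (+ 1 ℤ.* x ℤ.+ (ℤ.- + 3 ℤ.* y ℤ.+ 0ℤ)) ℤ.+ (+ 0 ℤ.* x ℤ.+ (+ 3 ℤ.* y ℤ.+ 0ℤ))
  lemma = ℤ-Solver.solve-∀
θ-leibniz f (suc (suc n)) = begin
  (1-3z+z² ⊛ θ f) (2 + n)
    ≡⟨ quadratic-⊛ (+ 1) (ℤ.- + 3) (+ 1) (θ f) n ⟩
  + 1 ℤ.* θ f (2 + n) ℤ.+ (ℤ.- + 3 ℤ.* θ f (suc n) ℤ.+ + 1 ℤ.* θ f n)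
    ≡⟨ lemma (+ n) (f (2 + n)) (f (suc n)) (f n) ⟩
  + (2 + n) ℤ.* (+ 1 ℤ.* f (2 + n) ℤ.+ (ℤ.- + 3 ℤ.* f (suc n) ℤ.+ + 1 ℤ.* f n))
    ℤ.+ (+ 0 ℤ.* f (2 + n) ℤ.+ (+ 3 ℤ.* f (suc n) ℤ.+ ℤ.- + 2 ℤ.* f n))
    ≡⟨ cong₂ (λ s t → + (2 + n) ℤ.* s ℤ.+ t) (quadratic-⊛ (+ 1) (ℤ.- + 3) (+ 1) f n)
         (quadratic-⊛ (+ 0) (+ 3) (ℤ.- + 2) f n) ⟨
  θ (1-3z+z² ⊛ f) (2 + n) ℤ.+ (3z-2z² ⊛ f) (2 + n)
    ∎
  where
  open ≡-Reasoning
  lemma : ∀ m x y z →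
    + 1 ℤ.* ((+ 2 ℤ.+ m) ℤ.* x) ℤ.+ (ℤ.- + 3 ℤ.* ((+ 1 ℤ.+ m) ℤ.* y) ℤ.+ + 1 ℤ.* (m ℤ.* z)) ≡
    (+ 2 ℤ.+ m) ℤ.* (+ 1 ℤ.* x ℤ.+ (ℤ.- + 3 ℤ.* y ℤ.+ + 1 ℤ.* z)) ℤ.+ (+ 0 ℤ.* x ℤ.+ (+ 3 ℤ.* y ℤ.+ ℤ.- + 2 ℤ.* z))
  lemma = ℤ-Solver.solve-∀

-- Multiplying by 1 - 3z + z² and cancelling replaces the derivative of an inverse by the product
-- rule and the case of `r` one lower.
θ-D⁻ : ∀ r n → θ (D⁻ r) n ≡ + r ℤ.* (3z-2z² ⊛ D⁻ (suc r)) n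
θ-D⁻ zero    zero    = refl
θ-D⁻ zero    (suc n) = trans (cong (+ suc n ℤ.*_) (D⁻-zero (suc n))) (ℤ.*-zeroʳ (+ suc n))
θ-D⁻ (suc r) n = ⊛-cancelˡ 1-3z+z² {θ (D⁻ (suc r))} {λ k → + suc r ℤ.* (3z-2z² ⊛ D⁻ (2 + r)) k} refl step n
  where
  open ≡-Reasoning
  distrib : ∀ r x → r ℤ.* x ℤ.+ x ≡ (+ 1 ℤ.+ r) ℤ.* x
  distrib = ℤ-Solver.solve-∀
  step : 1-3z+z² ⊛ θ (D⁻ (suc r)) ≗ 1-3z+z² ⊛ λ k → + suc r ℤ.* (3z-2z² ⊛ D⁻ (2 + r)) k
  step m = begin
    (1-3z+z² ⊛ θ (D⁻ (suc r))) m
      ≡⟨ θ-leibniz (D⁻ (suc r)) m ⟩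
    + m ℤ.* (1-3z+z² ⊛ D⁻ (suc r)) m ℤ.+ (3z-2z² ⊛ D⁻ (suc r)) m
      ≡⟨ cong (λ t → + m ℤ.* t ℤ.+ (3z-2z² ⊛ D⁻ (suc r)) m) (D⁻-suc r m) ⟩
    + m ℤ.* D⁻ r m ℤ.+ (3z-2z² ⊛ D⁻ (suc r)) m
      ≡⟨ cong (ℤ._+ (3z-2z² ⊛ D⁻ (suc r)) m) (θ-D⁻ r m) ⟩
    + r ℤ.* (3z-2z² ⊛ D⁻ (suc r)) m ℤ.+ (3z-2z² ⊛ D⁻ (suc r)) m
      ≡⟨ distrib (+ r) ((3z-2z² ⊛ D⁻ (suc r)) m) ⟩
    + suc r ℤ.* (3z-2z² ⊛ D⁻ (suc r)) m
      ≡⟨ cong (+ suc r ℤ.*_) (⊛-congˡ 3z-2z² (D⁻-suc (suc r)) m) ⟨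
    + suc r ℤ.* (3z-2z² ⊛ (1-3z+z² ⊛ D⁻ (2 + r))) m
      ≡⟨ cong (+ suc r ℤ.*_) (⊛-assoc 3z-2z² 1-3z+z² (D⁻ (2 + r)) m) ⟨
    + suc r ℤ.* ((3z-2z² ⊛ 1-3z+z²) ⊛ D⁻ (2 + r)) m
      ≡⟨ cong (+ suc r ℤ.*_) (⊛-congʳ (D⁻ (2 + r)) (⊛-comm 3z-2z² 1-3z+z²) m) ⟩
    + suc r ℤ.* ((1-3z+z² ⊛ 3z-2z²) ⊛ D⁻ (2 + r)) m
      ≡⟨ cong (+ suc r ℤ.*_) (⊛-assoc 1-3z+z² 3z-2z² (D⁻ (2 + r)) m) ⟩
    + suc r ℤ.* (1-3z+z² ⊛ (3z-2z² ⊛ D⁻ (2 + r))) m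
      ≡⟨ ⊛-scaleʳ 1-3z+z² (3z-2z² ⊛ D⁻ (2 + r)) (+ suc r) m ⟨
    (1-3z+z² ⊛ λ k → + suc r ℤ.* (3z-2z² ⊛ D⁻ (2 + r)) k) m
      ∎

private
  -- The two polynomials on the right add up to 1 - z². The first comes from `θ`, the second from
  -- writing `D⁻ r` as a multiple of `D⁻ (suc r)`.
  D⁻-weighted : ∀ r m → + (m + r) ℤ.* D⁻ r m ≡
                + r ℤ.* ((3z-2z² ⊛ D⁻ (suc r)) m ℤ.+ (1-3z+z² ⊛ D⁻ (suc r)) m)
  D⁻-weighted r m = begin
    + (m + r) ℤ.* D⁻ r m                      ≡⟨ cong (ℤ._* D⁻ r m) (ℤ.pos-+ m r) ⟩
    (+ m ℤ.+ + r) ℤ.* D⁻ r m                    ≡⟨ ℤ.*-distribʳ-+ (D⁻ r m) (+ m) (+ r) ⟩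
    + m ℤ.* D⁻ r m ℤ.+ + r ℤ.* D⁻ r m           ≡⟨ cong₂ (λ s t → s ℤ.+ + r ℤ.* t) (θ-D⁻ r m) (sym (D⁻-suc r m)) ⟩
    + r ℤ.* (3z-2z² ⊛ D⁻ (suc r)) m ℤ.+ + r ℤ.* (1-3z+z² ⊛ D⁻ (suc r)) m
                                                ≡⟨ ℤ.*-distribˡ-+ (+ r) _ _ ⟨
    + r ℤ.* ((3z-2z² ⊛ D⁻ (suc r)) m ℤ.+ (1-3z+z² ⊛ D⁻ (suc r)) m) ∎
    where open ≡-Reasoning

-- r (1 - z²) / (1 - 3z + z²)^(r+1) is (θ + r) applied to 1 / (1 - 3z + z²)^r.
D⁻-weighted-0 : ∀ r → + r ℤ.* D⁻ (suc r) 0 ≡ + r ℤ.* D⁻ r 0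
D⁻-weighted-0 r = cong (+ r ℤ.*_) (D⁻-suc-0 r)

D⁻-weighted-1 : ∀ r → + r ℤ.* D⁻ (suc r) 1 ≡ + (1 + r) ℤ.* D⁻ r 1
D⁻-weighted-1 r = sym (trans (D⁻-weighted r 1) (lemma (+ r) (D⁻ (suc r) 1) (D⁻ (suc r) 0)))
  where
  lemma : ∀ r x y → r ℤ.* ((+ 0 ℤ.* x ℤ.+ (+ 3 ℤ.* y ℤ.+ 0ℤ)) ℤ.+ (+ 1 ℤ.* x ℤ.+ (ℤ.- + 3 ℤ.* y ℤ.+ 0ℤ))) ≡ r ℤ.* x
  lemma = ℤ-Solver.solve-∀

D⁻-weighted-2+ : ∀ r m → + r ℤ.* D⁻ (suc r) (2 + m) ≡ + (2 + m + r) ℤ.* D⁻ r (2 + m) ℤ.+ + r ℤ.* D⁻ (suc r) m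
D⁻-weighted-2+ r m = sym (trans (cong (ℤ._+ + r ℤ.* D⁻ (suc r) m) (trans (D⁻-weighted r (2 + m))
  (cong (+ r ℤ.*_) (cong₂ ℤ._+_ (quadratic-⊛ (+ 0) (+ 3) (ℤ.- + 2) (D⁻ (suc r)) m)
    (quadratic-⊛ (+ 1) (ℤ.- + 3) (+ 1) (D⁻ (suc r)) m)))))
  (lemma (+ r) (D⁻ (suc r) (2 + m)) (D⁻ (suc r) (suc m)) (D⁻ (suc r) m)))
  where
  lemma : ∀ r x y z → r ℤ.* ((+ 0 ℤ.* x ℤ.+ (+ 3 ℤ.* y ℤ.+ ℤ.- + 2 ℤ.* z)) ℤ.+ (+ 1 ℤ.* x ℤ.+ (ℤ.- + 3 ℤ.* y ℤ.+ + 1 ℤ.* z)))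
          ℤ.+ r ℤ.* z ≡ r ℤ.* x
  lemma = ℤ-Solver.solve-∀

-- The partial sums of D⁻ r.
ΣD⁻ : ℕ → Series
ΣD⁻ r = (1-z ⊛ 1-3z+z² ^ r) ⁻¹

ΣD⁻-cancel : ∀ r → 1-z ⊛ ΣD⁻ r ≗ D⁻ r
ΣD⁻-cancel r = ⁻¹-cancelˡ 1-z (1-3z+z² ^ r) (1-3z+z²^r-constant r) (1-z⊛1-3z+z²^r-constant r)

ΣD⁻-0 : ∀ r → ΣD⁻ r 0 ≡ D⁻ r 0
ΣD⁻-0 r = trans (sym (trans (ℤ.+-identityʳ _) (ℤ.*-identityˡ _))) (ΣD⁻-cancel r 0)

ΣD⁻-suc : ∀ r n → ΣD⁻ r (suc n) ≡ D⁻ r (suc n) ℤ.+ ΣD⁻ r n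
ΣD⁻-suc r n = trans (lemma (ΣD⁻ r (suc n)) (ΣD⁻ r n)) (cong (ℤ._+ ΣD⁻ r n)
  (trans (sym (linear-⊛ (+ 1) (ℤ.- + 1) (ΣD⁻ r) n)) (ΣD⁻-cancel r (suc n))))
  where
  lemma : ∀ x y → x ≡ (+ 1 ℤ.* x ℤ.+ ℤ.- + 1 ℤ.* y) ℤ.+ y
  lemma = ℤ-Solver.solve-∀

1+z-⊛-0 : ∀ f → (1+z ⊛ f) 0 ≡ f 0
1+z-⊛-0 f = trans (ℤ.+-identityʳ _) (ℤ.*-identityˡ _)

1+z-⊛-suc : ∀ f n → (1+z ⊛ f) (suc n) ≡ f (suc n) ℤ.+ f n
1+z-⊛-suc f n = trans (linear-⊛ (+ 1) (+ 1) f n) (cong₂ ℤ._+_ (ℤ.*-identityˡ (f (suc n))) (ℤ.*-identityˡ (f n)))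

-- Word counts as coefficients

F-few : ∀ {n r} → n < r → F n r ≡ 0
F-few = linear-few all?

F-diagonal : ∀ n → F n n ≡ 1
F-diagonal zero          = F-0 0
F-diagonal (suc zero)    = trans (F-1 1) (cong₂ (λ x y → 3 * x + y) (F-0 1) (F-0 0))
F-diagonal (suc (suc n)) = begin
  F (2 + n) (2 + n)                                   ≡⟨ ℕ.+-identityʳ _ ⟨
  F (2 + n) (2 + n) + 0                               ≡⟨ cong (λ x → F (2 + n) (2 + n) + x) (F-few {n} (ℕ.m<n⇒m<1+n ℕ.≤-refl)) ⟨
  F (2 + n) (2 + n) + F n (2 + n)                     ≡⟨ F-2+ n (2 + n) ⟩
  3 * F (suc n) (2 + n) + F (suc n) (suc n)           ≡⟨ cong₂ (λ x y → 3 * x + y) (F-few {suc n} ℕ.≤-refl) (F-diagonal (suc n)) ⟩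
  1                                                   ∎
  where open ≡-Reasoning

private
  pos-rec : ∀ a b c d → a + b ≡ 3 * c + d → + a ℤ.+ + b ≡ + 3 ℤ.* + c ℤ.+ + d
  pos-rec a b c d eq = trans (sym (ℤ.pos-+ a b)) (trans (cong +_ eq)
    (trans (ℤ.pos-+ (3 * c) d) (cong (ℤ._+ + d) (ℤ.pos-* 3 c))))

-- Both sides obey one recurrence in `m`: the term with y lowers length and roots together, so it
-- keeps `m` and becomes `D⁻ r m`. For `r` equal to 0 this term is absent, just as `D⁻ 0` vanishes
-- at positive indices.
F≡D⁻ : ∀ r m → + F (m + r) r ≡ D⁻ (suc r) m
F≡D⁻ r zero = cong +_ (F-diagonal r)
F≡D⁻ zero (suc zero) = trans (cong +_ (trans (F-1 0) (cong (λ x → 3 * x + 0) (F-0 0))))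
  (sym (trans (D⁻-suc-1 0) (cong (λ t → + 3 ℤ.+ t) (D⁻-zero 1))))
F≡D⁻ (suc r) (suc zero) = begin
  + F (2 + r) (suc r)
    ≡⟨ ℤ.+-identityʳ _ ⟨
  + F (2 + r) (suc r) ℤ.+ 0ℤ
    ≡⟨ cong (λ x → + F (2 + r) (suc r) ℤ.+ + x) (F-few {r} ℕ.≤-refl) ⟨
  + F (2 + r) (suc r) ℤ.+ + F r (suc r)
    ≡⟨ pos-rec (F (2 + r) (suc r)) (F r (suc r)) (F (suc r) (suc r)) (F (suc r) r) (F-2+ r (suc r)) ⟩
  + 3 ℤ.* + F (suc r) (suc r) ℤ.+ + F (suc r) r
    ≡⟨ cong₂ (λ x y → + 3 ℤ.* x ℤ.+ y) (F≡D⁻ (suc r) 0) (F≡D⁻ r 1) ⟩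
  + 3 ℤ.* D⁻ (2 + r) 0 ℤ.+ D⁻ (suc r) 1
    ≡⟨ D⁻-suc-1 (suc r) ⟨
  D⁻ (2 + r) 1
    ∎
  where open ≡-Reasoning
F≡D⁻ zero (suc (suc m)) = ℤ+.∙-cancelʳ (D⁻ 1 m) _ _ (begin
  + F (2 + m + 0) 0 ℤ.+ D⁻ 1 m
    ≡⟨ cong (λ x → + F (2 + m + 0) 0 ℤ.+ x) (F≡D⁻ 0 m) ⟨
  + F (2 + m + 0) 0 ℤ.+ + F (m + 0) 0
    ≡⟨ pos-rec (F (2 + m + 0) 0) (F (m + 0) 0) (F (suc m + 0) 0) 0 (F-2+ (m + 0) 0) ⟩
  + 3 ℤ.* + F (suc m + 0) 0 ℤ.+ 0ℤ
    ≡⟨ cong₂ (λ x y → + 3 ℤ.* x ℤ.+ y) (F≡D⁻ 0 (suc m)) (sym (D⁻-zero (2 + m))) ⟩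
  + 3 ℤ.* D⁻ 1 (suc m) ℤ.+ D⁻ 0 (2 + m)
    ≡⟨ D⁻-suc-2+ 0 m ⟨
  D⁻ 1 (2 + m) ℤ.+ D⁻ 1 m
    ∎)
  where open ≡-Reasoning
F≡D⁻ (suc r) (suc (suc m)) = ℤ+.∙-cancelʳ (D⁻ (2 + r) m) _ _ (begin
  + F (2 + m + suc r) (suc r) ℤ.+ D⁻ (2 + r) m
    ≡⟨ cong (λ x → + F (2 + m + suc r) (suc r) ℤ.+ x) (F≡D⁻ (suc r) m) ⟨
  + F (2 + m + suc r) (suc r) ℤ.+ + F (m + suc r) (suc r)
    ≡⟨ pos-rec (F (2 + m + suc r) (suc r)) (F (m + suc r) (suc r)) (F (suc m + suc r) (suc r)) (F (suc m + suc r) r)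
           (F-2+ (m + suc r) (suc r)) ⟩
  + 3 ℤ.* + F (suc m + suc r) (suc r) ℤ.+ + F (suc m + suc r) r
    ≡⟨ cong₂ (λ x y → + 3 ℤ.* x ℤ.+ y) (F≡D⁻ (suc r) (suc m))
         (trans (cong (λ x → + F x r) (ℕ.+-suc (suc m) r)) (F≡D⁻ r (2 + m))) ⟩
  + 3 ℤ.* D⁻ (2 + r) (suc m) ℤ.+ D⁻ (suc r) (2 + m)
    ≡⟨ D⁻-suc-2+ (suc r) m ⟨
  D⁻ (2 + r) (2 + m) ℤ.+ D⁻ (2 + r) m
    ∎)
  where open ≡-Reasoning

partialSum-few : ∀ {n r} → n ≤ r → partialSum F n r ≡ 0
partialSum-few {zero}      n≤r = refl
partialSum-few {suc n} {r} n<r = cong₂ _+_ (F-few {n} n<r) (partialSum-few {n} (ℕ.<⇒≤ n<r))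

-- Words shorter than `r` contribute nothing, so the sum in effect starts at the length `r`, which
-- is the coefficient 0 of `D⁻ (suc r)`.
partialSum≡ΣD⁻ : ∀ r m → + partialSum F (suc (m + r)) r ≡ ΣD⁻ (suc r) m
partialSum≡ΣD⁻ r zero = trans (cong +_ (trans (cong (λ x → F r r + x) (partialSum-few {r} ℕ.≤-refl)) (ℕ.+-identityʳ _)))
  (trans (F≡D⁻ r 0) (sym (ΣD⁻-0 (suc r))))
partialSum≡ΣD⁻ r (suc m) = trans (ℤ.pos-+ (F (suc m + r) r) _)
  (trans (cong₂ ℤ._+_ (F≡D⁻ r (suc m)) (partialSum≡ΣD⁻ r m)) (sym (ΣD⁻-suc (suc r) m)))

partialSums≡ : ∀ r m → + (partialSum F (suc (m + r)) r + partialSum F (m + r) r) ≡ (1+z ⊛ ΣD⁻ (suc r)) m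
partialSums≡ r m = trans (ℤ.pos-+ (partialSum F (suc (m + r)) r) _) (by-cases m)
  where
  by-cases : ∀ m → + partialSum F (suc (m + r)) r ℤ.+ + partialSum F (m + r) r ≡ (1+z ⊛ ΣD⁻ (suc r)) m
  by-cases zero    = trans (cong₂ (λ x y → x ℤ.+ + y) (partialSum≡ΣD⁻ r 0) (partialSum-few {r} ℕ.≤-refl))
    (trans (ℤ.+-identityʳ _) (sym (1+z-⊛-0 (ΣD⁻ (suc r)))))
  by-cases (suc m) = trans (cong₂ ℤ._+_ (partialSum≡ΣD⁻ r (suc m)) (partialSum≡ΣD⁻ r m))
    (sym (1+z-⊛-suc (ΣD⁻ (suc r)) m))

-- The hypothesis on `c` is the factor 1 - z². For `m` at most 1 the subtracted coefficient does not
-- exist, and correspondingly `F n r` vanishes because `n` is less than `r`.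
cyclic-weighted : ∀ m r {n} c → 2 + n ≡ m + r → c + F n r ≡ F (2 + n) r → + r ℤ.* + c ≡ + (m + r) ℤ.* D⁻ r m
cyclic-weighted m r {n} c N≡m+r eq = by-cases m N≡m+r
  where
  open ≡-Reasoning
  few : n < r → ∀ m → 2 + n ≡ m + r → + r ℤ.* + c ≡ + r ℤ.* D⁻ (suc r) m
  few n<r m e = cong (+ r ℤ.*_) (begin
    + c                 ≡⟨ cong +_ (ℕ.+-identityʳ c) ⟨
    + (c + 0)           ≡⟨ cong (λ x → + (c + x)) (F-few {n} n<r) ⟨
    + (c + F n r)       ≡⟨ cong +_ (trans eq (cong (λ x → F x r) e)) ⟩
    + F (m + r) r       ≡⟨ F≡D⁻ r m ⟩
    D⁻ (suc r) m        ∎)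
  by-cases : ∀ m → 2 + n ≡ m + r → + r ℤ.* + c ≡ + (m + r) ℤ.* D⁻ r m
  by-cases zero e = trans (few (ℕ.≤-trans (ℕ.n≤1+n (suc n)) (ℕ.≤-reflexive e)) 0 e) (D⁻-weighted-0 r)
  by-cases (suc zero) e = trans (few (ℕ.≤-reflexive (ℕ.suc-injective e)) 1 e) (D⁻-weighted-1 r)
  by-cases (suc (suc m)) e = ℤ+.∙-cancelʳ (+ r ℤ.* D⁻ (suc r) m) _ _ (begin
    + r ℤ.* + c ℤ.+ + r ℤ.* D⁻ (suc r) m       ≡⟨ ℤ.*-distribˡ-+ (+ r) (+ c) (D⁻ (suc r) m) ⟨
    + r ℤ.* (+ c ℤ.+ D⁻ (suc r) m)             ≡⟨ cong (λ x → + r ℤ.* (+ c ℤ.+ x)) (F≡D⁻ r m) ⟨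
    + r ℤ.* (+ c ℤ.+ + F (m + r) r)            ≡⟨ cong (λ x → + r ℤ.* (+ c ℤ.+ + F x r)) (ℕ.suc-injective (ℕ.suc-injective e)) ⟨
    + r ℤ.* (+ c ℤ.+ + F n r)                  ≡⟨ cong (λ x → + r ℤ.* x) (ℤ.pos-+ c (F n r)) ⟨
    + r ℤ.* + (c + F n r)                      ≡⟨ cong (λ x → + r ℤ.* + x) (trans eq (cong (λ x → F x r) e)) ⟩
    + r ℤ.* + F (2 + m + r) r                  ≡⟨ cong (+ r ℤ.*_) (F≡D⁻ r (2 + m)) ⟩
    + r ℤ.* D⁻ (suc r) (2 + m)                 ≡⟨ D⁻-weighted-2+ r m ⟩
    + (2 + m + r) ℤ.* D⁻ r (2 + m) ℤ.+ + r ℤ.* D⁻ (suc r) m ∎)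

-- Evaluation of the two sums

module _ (k : ℕ) (3≤N : 3 ≤ 3 + k) where
  open Wheel k 3≤N using (N)
  open Counting k 3≤N
  open CountWords k 3≤N

  A-coefficient : ∀ r → suc r ≤ N → + A N 3≤N (suc r) ≡ + N ℤ.* (1+z ⊛ ΣD⁻ (suc r)) (N ∸ suc r)
  A-coefficient r r<N = begin
    + A N 3≤N (suc r)
      ≡⟨ cong +_ (trans (A-words r) (cong (N *_) (count-hubRooted r))) ⟩
    + (N * (partialSum F N r + partialSum F (2 + k) r))
      ≡⟨ ℤ.pos-* N (partialSum F N r + partialSum F (2 + k) r) ⟩
    + N ℤ.* + (partialSum F N r + partialSum F (2 + k) r)
      ≡⟨ cong (λ x → + N ℤ.* + (partialSum F (suc x) r + partialSum F x r)) (ℕ.m∸n+n≡m (ℕ.≤-pred r<N)) ⟨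
    + N ℤ.* + (partialSum F (suc (N ∸ suc r + r)) r + partialSum F (N ∸ suc r + r) r)
      ≡⟨ cong (+ N ℤ.*_) (partialSums≡ r (N ∸ suc r)) ⟩
    + N ℤ.* (1+z ⊛ ΣD⁻ (suc r)) (N ∸ suc r)
      ∎
    where open ≡-Reasoning

  B-coefficient : ∀ r → suc r ≤ N → + suc r ℤ.* + B N 3≤N (suc r) ≡ + N ℤ.* D⁻ (suc r) (N ∸ suc r)
  B-coefficient r r<N = trans (cyclic-weighted (N ∸ suc r) (suc r) (B N 3≤N (suc r)) (sym m+r≡N) (begin
      -- The added term counts the words ◂ u ▸ with u arbitrary of length `suc k`, the linear words
      -- that are not good as cyclic words.
      B N 3≤N (suc r) + F (suc k) (suc r)
        ≡⟨ cong (_+ F (suc k) (suc r)) (trans (B-words r) (count-rooted (suc r))) ⟩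
      F (2 + k) r + (F (2 + k) (suc r) + (E (2 + k) (suc r) + E (2 + k) (suc r))) + F (suc k) (suc r)
        ≡⟨ lemma (F (2 + k) r) (F (2 + k) (suc r)) (E (2 + k) (suc r)) (F (suc k) (suc r)) ⟩
      F (2 + k) r + (F (2 + k) (suc r) + ((E (2 + k) (suc r) + F (suc k) (suc r)) + E (2 + k) (suc r)))
        ≡⟨ cong (λ x → F (2 + k) r + (F (2 + k) (suc r) + (x + E (2 + k) (suc r)))) (F≡E+F (suc k) (suc r)) ⟨
      F (2 + k) r + (F (2 + k) (suc r) + (F (2 + k) (suc r) + E (2 + k) (suc r)))
        ≡⟨ F-suc (2 + k) (suc r) ⟨
      F (3 + k) (suc r)
        ∎))
    (cong (λ x → + x ℤ.* D⁻ (suc r) (N ∸ suc r)) m+r≡N)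
    where
    open ≡-Reasoning
    m+r≡N : N ∸ suc r + suc r ≡ N
    m+r≡N = ℕ.m∸n+n≡m r<N
    lemma : ∀ x f e g → x + (f + (e + e)) + g ≡ x + (f + ((e + g) + e))
    lemma = ℕ-Solver.solve-∀

/-intro : ∀ (x y z : ℤ) r → + suc r ℤ.* x ≡ y ℤ.* z → x / 1 ≡ (y / suc r) ℚ.* (z / 1)
/-intro x y z r eq = ℚ.toℚᵘ-injective (begin
  ℚ.toℚᵘ (x / 1)                             ≈⟨ ℚ.toℚᵘ-fromℚᵘ (mkℚᵘ x 0) ⟩
  mkℚᵘ x 0                                   ≈⟨ *≡* cross ⟩
  mkℚᵘ y r ℚᵘ.* mkℚᵘ z 0                     ≈⟨ ℚᵘ.*-cong (ℚ.toℚᵘ-fromℚᵘ (mkℚᵘ y r)) (ℚ.toℚᵘ-fromℚᵘ (mkℚᵘ z 0)) ⟨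
  ℚ.toℚᵘ (y / suc r) ℚᵘ.* ℚ.toℚᵘ (z / 1)     ≈⟨ ℚ.toℚᵘ-homo-* (y / suc r) (z / 1) ⟨
  ℚ.toℚᵘ ((y / suc r) ℚ.* (z / 1))           ∎)
  where
  open ℚᵘ.≃-Reasoning
  cross : x ℤ.* + (suc r * 1) ≡ y ℤ.* z ℤ.* + 1
  cross = trans (cong (λ d → x ℤ.* + d) (ℕ.*-identityʳ (suc r)))
    (trans (ℤ.*-comm x (+ suc r)) (trans eq (sym (ℤ.*-identityʳ (y ℤ.* z)))))

theorem4p1 : (N : ℕ) (3≤N : 3 ≤ N) (r : ℕ) (1≤r : 1 ≤ r) → r ≤ N →
    (+ A N 3≤N r ≡ + N ℤ.* ([z^ N ∸ r ] (1+z ⊘ (1-z ⊛ 1-3z+z² ^ r))))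
    × (+ B N 3≤N r / 1 ≡ ((+ N / r) {{>-nonZero 1≤r}}) ℚ.* (([z^ N ∸ r ] ((1-3z+z² ^ r) ⁻¹)) / 1))
theorem4p1 (suc (suc (suc k))) 3≤N@(s≤s (s≤s (s≤s z≤n))) (suc r) 1≤r r<N =
    A-coefficient k 3≤N r r<N
  , /-intro (+ B (3 + k) 3≤N (suc r)) (+ (3 + k)) (D⁻ (suc r) ((3 + k) ∸ suc r)) r (B-coefficient k 3≤N r r<N)
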